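{- The functors $\mathtt F:\mathbf M\to(\mathbf{SRF}^*_{\nu\mathrm M})^{\mathrm{op}}$ and $\mathtt L^*:(\mathbf{SRF}^*_{\nu\mathrm M})^{\mathrm{op}}\to\mathbf M$ are well defined and form a categorical duality (dual equivalence): for every $\mathbf L\in\mathbf M$, $a\mapsto X_a$ is an isomorphism $\mathbf L\cong\mathtt L^*\mathtt F(\mathbf L)$, and for every frame $\mathfrak F$ in $\mathbf{SRF}^*_{\nu\mathrm M}$, $\mathfrak F\cong\mathtt F\mathtt L^*(\mathfrak F)$. No use of the axiom of choice is made.
   Context: $\mathbf M$: category of bounded lattices with a minimal quasi-complement (antitone $\nu$, $\nu0=1$, $\nu(a\vee b)=\nu a\wedge\nu b$) with homomorphisms. Frames $\mathfrak F=(X,\parallel,Y,S_\vee)$: $X,Y$ nonempty, ${\parallel}\subseteq X\times Y$ with complement $I$, $S_\vee\subseteq Y\times X$. $U'=\{y:\forall x\in U\,x\parallel y\}$, $V'=\{x:\forall y\in V\,x\parallel y\}$; stable $A=A''\subseteq X$ form $\mathcal G(X)$, co-stable $B=B''\subseteq Y$ form $\mathcal G(Y)$; $x\preceq z$ iff $\{x\}'\subseteq\{z\}'$, same on $Y$; $\Gamma u$ = up-set of $u$; closed elements: sets $\Gamma u$; a closed element $\Gamma x$ of $\mathcal G(X)$ is clopen if $\Gamma x=\{y\}'$ for some $y\in Y$ (dually for $\mathcal G(Y)$). $S_\vee x=\{y:yS_\vee x\}$, $yS_\vee=\{x:yS_\vee x\}$, $zS'_\vee x$ iff $\forall y(yS_\vee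 x\Rightarrow z\parallel y)$. Objects of $\mathbf{SRF}^*_{\nu\mathrm M}$ satisfy: (F0) $\forall x\exists y\,xIy$, $\forall y\exists x\,xIy$; (F1) $\preceq$ are partial orders; (F2) each $S_\vee x$ is a closed element of $\mathcal G(Y)$, and clopen whenever $\Gamma x$ is clopen; (F3) each $yS_\vee$ is a down-set; (F4) for each $x$, $\{z:zS'_\vee x\}\in\mathcal G(X)$, for each $z$, $\{x:zS'_\vee x\}\in\mathcal G(X)$; (F5) clopen elements of $\mathcal G(X)$ and of $\mathcal G(Y)$ are closed under finite intersections; (F6) the closed elements of each of $\mathcal G(X),\mathcal G(Y)$ are exactly the intersections of families of clopen elements; (F7) each of $X,Y$ with the topology generated by the basis of its clopen elements is a spectral space. Morphisms $\pi=(p,q):\mathfrak F_2\to\mathfrak F_1$, $p:X_2\to X_1$, $q:Y_2\to Y_1$, satisfying (M1) $x'I_2y'\Rightarrow p(x')I_1q(y')$; (M2) $xI_1q(y')\Rightarrow\exists x'(x\le p(x')\wedge x'I_2y')$; (M3) $p(x')I_1y\Rightarrow\exists y'(y\le q(y')\wedge x'I_2y')$; (M4) $q(v)S_{1}z\Rightarrow\exists x\in X_2(z\le p(x)\wedge vS_{2}x)$; (M5) for each point $u$ of $X_1$ (resp. $Y_1$), $p^{ -1}(\Gamma u)$ (resp. $q^{ -1}(\Gamma u)$) equals $\Gamma v$ for some point $v$. Functor $\mathtt F$: $\mathtt F(\mathbf L)$ is the canonical frame ($X$ proper filters, $Y$ proper ideals, $x\parallel y$ iff $x\cap y\ne\emptyset$,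 $yS_\vee x$ iff the ideal generated by $\{\nu a:a\in x\}$ is contained in $y$); for $h:\mathbf L_2\to\mathbf L_1$, $\mathtt F(h)=(h^{ -1}[\cdot],h^{ -1}[\cdot]):\mathtt F(\mathbf L_1)\to\mathtt F(\mathbf L_2)$. Functor $\mathtt L^*$: $\mathtt L^*(\mathfrak F)$ is the algebra of clopen elements of $\mathcal G(X)$ with $\cap$, $A\vee C=(A\cup C)''$, $\emptyset$, $X$ and $A^*=\{x:\forall z\in A\;xS'_\vee z\}$; $\mathtt L^*(p,q)=p^{ -1}$ restricted to clopens. $X_a=\{x: a\in x\}$.
   Formalization: Formal version: ∅ also counts as closed and the whole space as open (else L* lacks its bounds); 0≠1 in M; M4 is an equivalence; frames also need each {y}' open and each yS_∨ closed in X's topology. Without these the stated claim fails: p⁻¹ may not preserve *, and 𝔉≅FL*(𝔉) can fail. -}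

module Defs where

open import Level using (Level; suc; _⊔_; 0ℓ)
open import Axiom.ExcludedMiddle using (ExcludedMiddle)
open import Data.Bool.Base using (Bool; true; false; T) renaming (_∧_ to _∧ᵇ_)
open import Data.List.Base using (List; foldr)
open import Data.List.Relation.Unary.All as All using (All)
open import Data.List.Relation.Unary.Any using (Any)
open import Data.Product.Base using (Σ; ∃; ∃-syntax; Σ-syntax; _×_; _,_; proj₁; proj₂)
open import Data.Sum.Base using (_⊎_; inj₁; inj₂)
open import Function.Base using (_∘_; flip)
open import Function.Bundles using (Func; _⇔_; mk⇔; module Equivalence)
import Function.Construct.Identity as Id
import Function.Construct.Composition as Comp
open import Relation.Binary.Bundles using (Setoid)
open import Relation.Binary.Core using (Rel)
open import Relation.Binary.Lattice.Bundles using (BoundedLattice)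
open import Relation.Binary.Lattice.Structures using (IsBoundedLattice)
open import Relation.Binary.Structures using (IsEquivalence; IsPartialOrder)
open import Relation.Nullary.Decidable.Core using (does)
open import Relation.Nullary.Negation.Core using (¬_)
open import Relation.Unary
  using (Pred; _⊆_; _≐_; ∁; _∪_; _∩_; ⋃; ⋂; _≬_; U; Empty; Universal; Satisfiable)

private
  variable
    ℓ l l′ : Level

record Category (o m e : Level) : Set (suc (o ⊔ m ⊔ e)) where
  infix  4 _≈_ _⇒_
  infixr 9 _∙_
  field
    Obj       : Set o
    _⇒_       : Rel Obj m
    _≈_       : ∀ {A B} → Rel (A ⇒ B) e
    id        : ∀ {A} → A ⇒ A
    _∙_       : ∀ {A B C} → B ⇒ C → A ⇒ B → A ⇒ C
    ≈-equiv   : ∀ {A B} → IsEquivalence (_≈_ {A} {B})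
    ∙-cong    : ∀ {A B C} {f g : B ⇒ C} {h k : A ⇒ B} →
                f ≈ g → h ≈ k → f ∙ h ≈ g ∙ k
    identityˡ : ∀ {A B} (f : A ⇒ B) → id ∙ f ≈ f
    identityʳ : ∀ {A B} (f : A ⇒ B) → f ∙ id ≈ f
    assoc     : ∀ {A B C D} (f : C ⇒ D) (g : B ⇒ C) (h : A ⇒ B) →
                (f ∙ g) ∙ h ≈ f ∙ (g ∙ h)

op : ∀ {o m e} → Category o m e → Category o m e
op C = record
  { Obj       = Obj
  ; _⇒_       = flip _⇒_
  ; _≈_       = _≈_
  ; id        = id
  ; _∙_       = flip _∙_
  ; ≈-equiv   = ≈-equiv
  ; ∙-cong    = λ p q → ∙-cong q p
  ; identityˡ = identityʳ
  ; identityʳ = identityˡ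
  ; assoc     = λ f g h → IsEquivalence.sym ≈-equiv (assoc h g f)
  }
  where open Category C

record Functor {o m e o′ m′ e′} (C : Category o m e) (D : Category o′ m′ e′)
               : Set (o ⊔ m ⊔ e ⊔ o′ ⊔ m′ ⊔ e′) where
  private
    module C = Category C
    module D = Category D
  field
    F₀     : C.Obj → D.Obj
    F₁     : ∀ {A B} → A C.⇒ B → F₀ A D.⇒ F₀ B
    F-cong : ∀ {A B} {f g : A C.⇒ B} → f C.≈ g → F₁ f D.≈ F₁ g
    F-id   : ∀ {A} → F₁ (C.id {A}) D.≈ D.id
    F-∙    : ∀ {A B C} (f : B C.⇒ C) (g : A C.⇒ B) → F₁ (f C.∙ g) D.≈ F₁ f D.∙ F₁ g

idF : ∀ {o m e} {C : Category o m e} → Functor C C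
idF {C = C} = record
  { F₀ = λ A → A ; F₁ = λ f → f ; F-cong = λ p → p
  ; F-id = refl ; F-∙ = λ _ _ → refl }
  where
  open Category C
  refl : ∀ {A B} {f : A ⇒ B} → f ≈ f
  refl = IsEquivalence.refl ≈-equiv

infixr 9 _∘F_
_∘F_ : ∀ {o m e o′ m′ e′ o″ m″ e″}
         {C : Category o m e} {D : Category o′ m′ e′} {E : Category o″ m″ e″} →
       Functor D E → Functor C D → Functor C E
_∘F_ {E = E} G F = record
  { F₀     = λ A → G.F₀ (F.F₀ A)
  ; F₁     = λ f → G.F₁ (F.F₁ f)
  ; F-cong = λ p → G.F-cong (F.F-cong p)
  ; F-id   = trans (G.F-cong F.F-id) G.F-id
  ; F-∙    = λ f g → trans (G.F-cong (F.F-∙ f g)) (G.F-∙ (F.F₁ f) (F.F₁ g))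
  }
  where
  module F = Functor F
  module G = Functor G
  open Category E
  trans : ∀ {A B} {f g h : A ⇒ B} → f ≈ g → g ≈ h → f ≈ h
  trans = IsEquivalence.trans ≈-equiv

record NaturalIsomorphism {o m e o′ m′ e′}
         {C : Category o m e} {D : Category o′ m′ e′} (F G : Functor C D)
         : Set (o ⊔ m ⊔ m′ ⊔ e′) where
  private
    module C = Category C
    module F = Functor F
    module G = Functor G
  open Category D
  field
    to      : ∀ A → F.F₀ A ⇒ G.F₀ A
    from    : ∀ A → G.F₀ A ⇒ F.F₀ A
    to∙from : ∀ A → to A ∙ from A ≈ id
    from∙to : ∀ A → from A ∙ to A ≈ id
    natural : ∀ {A B} (f : A C.⇒ B) → to B ∙ F.F₁ f ≈ G.F₁ f ∙ to A

-- The one-element lattice has no proper filter, so its canonical frame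
-- would be empty; it is excluded by ⊥≉⊤.

record QLattice (ℓ : Level) : Set (suc ℓ) where
  field
    boundedLattice : BoundedLattice ℓ ℓ ℓ
  open BoundedLattice boundedLattice public
  field
    ν          : Carrier → Carrier
    ν-antitone : ∀ {a b} → a ≤ b → ν b ≤ ν a
    ν-⊥        : ν ⊥ ≈ ⊤
    ν-∨        : ∀ a b → ν (a ∨ b) ≈ ν a ∧ ν b
    ⊥≉⊤        : ¬ (⊥ ≈ ⊤)

record QHom (K L : QLattice ℓ) : Set ℓ where
  private
    module K = QLattice K
    module L = QLattice L
  field
    func : Func K.setoid L.setoid
  open Func func public
  field
    ∨-homo : ∀ a b → to (a K.∨ b) L.≈ to a L.∨ to b
    ∧-homo : ∀ a b → to (a K.∧ b) L.≈ to a L.∧ to b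
    ⊥-homo : to K.⊥ L.≈ L.⊥
    ⊤-homo : to K.⊤ L.≈ L.⊤
    ν-homo : ∀ a → to (K.ν a) L.≈ L.ν (to a)

  mono : ∀ {a b} → a K.≤ b → to a L.≤ to b
  mono {a} {b} a≤b = L.trans (L.reflexive (L.Eq.trans (cong a≈a∧b) (∧-homo a b))) (L.x∧y≤y _ _)
    where
    a≈a∧b : a K.≈ a K.∧ b
    a≈a∧b = K.antisym (K.∧-greatest K.refl a≤b) (K.x∧y≤x _ _)

idHom : (L : QLattice ℓ) → QHom L L
idHom L = record
  { func = Id.function setoid
  ; ∨-homo = λ _ _ → Eq.refl ; ∧-homo = λ _ _ → Eq.refl
  ; ⊥-homo = Eq.refl ; ⊤-homo = Eq.refl ; ν-homo = λ _ → Eq.refl }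
  where open QLattice L

_∘H_ : {J K L : QLattice ℓ} → QHom K L → QHom J K → QHom J L
_∘H_ {L = L} g f = record
  { func   = Comp.function f.func g.func
  ; ∨-homo = λ a b → Eq.trans (g.cong (f.∨-homo a b)) (g.∨-homo _ _)
  ; ∧-homo = λ a b → Eq.trans (g.cong (f.∧-homo a b)) (g.∧-homo _ _)
  ; ⊥-homo = Eq.trans (g.cong f.⊥-homo) g.⊥-homo
  ; ⊤-homo = Eq.trans (g.cong f.⊤-homo) g.⊤-homo
  ; ν-homo = λ a → Eq.trans (g.cong (f.ν-homo a)) (g.ν-homo _) }
  where
  open QLattice L
  module f = QHom f
  module g = QHom g

𝐌 : ∀ ℓ → Category (suc ℓ) ℓ ℓ
𝐌 ℓ = record
  { Obj       = QLattice ℓ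
  ; _⇒_       = QHom
  ; _≈_       = λ {_} {L} f g → ∀ a → QLattice._≈_ L (QHom.to f a) (QHom.to g a)
  ; id        = λ {L} → idHom L
  ; _∙_       = _∘H_
  ; ≈-equiv   = λ {_} {L} → record
      { refl  = λ _ → QLattice.Eq.refl L
      ; sym   = λ p a → QLattice.Eq.sym L (p a)
      ; trans = λ p q a → QLattice.Eq.trans L (p a) (q a) }
  ; ∙-cong    = λ {_} {_} {L} {f} {g} {h} {k} p q a →
                  QLattice.Eq.trans L (QHom.cong f (q a)) (p (QHom.to k a))
  ; identityˡ = λ {_} {L} _ _ → QLattice.Eq.refl L
  ; identityʳ = λ {_} {L} _ _ → QLattice.Eq.refl L
  ; assoc     = λ {_} {_} {_} {L} _ _ _ _ → QLattice.Eq.refl L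
  }

-- Sets that must themselves be collected into a set of the same universe
-- level (filters, ideals, clopen elements) are given by characteristic
-- functions; excluded middle turns every predicate into one.

⟦_⟧ : {A : Set ℓ} → (A → Bool) → Pred A 0ℓ
⟦ f ⟧ = T ∘ f

⌊_⌋[_] : {A : Set ℓ} → Pred A ℓ → ExcludedMiddle ℓ → A → Bool
⌊ P ⌋[ em ] x = does (em {P x})

module Topology {ℓ} (X : Setoid ℓ ℓ) {B : Set ℓ} (basic : B → Pred (Setoid.Carrier X) l) where
  open Setoid X renaming (Carrier to ∣X∣)

  OpenSet : Pred ∣X∣ ℓ → Set (ℓ ⊔ l)
  OpenSet V = ∀ {x} → V x → ∃[ b ] basic b x × basic b ⊆ V

  ClosedSet : Pred ∣X∣ ℓ → Set (ℓ ⊔ l)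
  ClosedSet C = OpenSet (∁ C)

  Compact : Pred ∣X∣ l′ → Set (suc ℓ ⊔ l ⊔ l′)
  Compact K = ∀ {I : Set ℓ} (V : I → Pred ∣X∣ ℓ) → (∀ i → OpenSet (V i)) → K ⊆ ⋃ I V →
              ∃[ is ] (∀ {x} → K x → Any (λ i → V i x) is)

  Irreducible : Pred ∣X∣ ℓ → Set (suc ℓ ⊔ l)
  Irreducible C = Satisfiable C ×
    (∀ D E → ClosedSet D → ClosedSet E → C ⊆ D ∪ E → C ⊆ D ⊎ C ⊆ E)

  IsClosureOf : Pred ∣X∣ ℓ → ∣X∣ → Set (suc ℓ ⊔ l)
  IsClosureOf C x = ClosedSet C × C x × (∀ D → ClosedSet D → D x → C ⊆ D)

  -- Uniqueness of generic points follows from T₀.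

  record IsSpectral : Set (suc ℓ ⊔ l) where
    field
      T₀            : ∀ x y → (∀ V → OpenSet V → V x ⇔ V y) → x ≈ y
      compact       : Compact {0ℓ} U
      compact-∩     : ∀ K N → OpenSet K → Compact K → OpenSet N → Compact N → Compact (K ∩ N)
      compact-basis : ∀ V → OpenSet V → ∀ {x} → V x →
                      ∃[ K ] OpenSet K × Compact K × K x × K ⊆ V
      sober         : ∀ C → ClosedSet C → Irreducible C → ∃[ x ] IsClosureOf C x

record Polarity (ℓ : Level) : Set (suc ℓ) where
  field
    X Y    : Setoid ℓ ℓ
  open Setoid X public using () renaming (Carrier to ∣X∣; _≈_ to _≈ˣ_)
  open Setoid Y public using () renaming (Carrier to ∣Y∣; _≈_ to _≈ʸ_)
  infix 4 _∥_
  field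
    _∥_    : ∣X∣ → ∣Y∣ → Set ℓ
    ∥-resp : ∀ {x x′ y y′} → x ≈ˣ x′ → y ≈ʸ y′ → x ∥ y → x′ ∥ y′

dual : Polarity ℓ → Polarity ℓ
dual P = record { X = Y ; Y = X ; _∥_ = flip _∥_ ; ∥-resp = flip ∥-resp }
  where open Polarity P

-- The definitions concern subsets of X; those for Y are obtained by
-- applying the module to the dual polarity.

module Galois {ℓ} (P : Polarity ℓ) where
  open Polarity P

  infix 9 _▹ _◃
  _▹ : Pred ∣X∣ l → Pred ∣Y∣ (ℓ ⊔ l)
  (A ▹) y = ∀ x → A x → x ∥ y

  _◃ : Pred ∣Y∣ l → Pred ∣X∣ (ℓ ⊔ l)
  (B ◃) x = ∀ y → B y → x ∥ y

  Stable : Pred ∣X∣ l → Set (ℓ ⊔ l)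
  Stable A = A ≐ (A ▹) ◃

  infix 4 _⪯_
  _⪯_ : Rel ∣X∣ ℓ
  x ⪯ z = ∀ y → x ∥ y → z ∥ y

  Γ : ∣X∣ → Pred ∣X∣ ℓ
  Γ x = x ⪯_

  -- In a canonical frame the closed elements are the sets of proper
  -- filters extending a given filter and the open elements are the sets
  -- of proper filters meeting a given ideal.  An improper filter thus
  -- contributes ∅ to the former and an improper ideal contributes the
  -- whole space to the latter.  Without these two the bounds ∅ and X of
  -- the lattice of clopen elements would not be clopen.

  Closed : Pred ∣X∣ l → Set (ℓ ⊔ l)
  Closed A = (∃[ x ] A ≐ Γ x) ⊎ Empty A

  Open : Pred ∣X∣ l → Set (ℓ ⊔ l)
  Open A = (∃[ y ] A ≐ (_∥ y)) ⊎ Universal A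

  IsClopen : Pred ∣X∣ l → Set (ℓ ⊔ l)
  IsClopen A = Closed A × Open A

  Clopen : Set ℓ
  Clopen = Σ[ A ∈ (∣X∣ → Bool) ] IsClopen ⟦ A ⟧

  infix 4 _∋ᶜ_ _∈ᶜ_ _⊆ᶜ_ _≈ᶜ_
  _∋ᶜ_ : Clopen → Pred ∣X∣ 0ℓ
  A ∋ᶜ x = ⟦ proj₁ A ⟧ x

  _∈ᶜ_ : ∣X∣ → Clopen → Set
  x ∈ᶜ A = A ∋ᶜ x

  _⊆ᶜ_ : Rel Clopen ℓ
  A ⊆ᶜ C = (_∈ᶜ A) ⊆ (_∈ᶜ C)

  _≈ᶜ_ : Rel Clopen ℓ
  A ≈ᶜ C = (_∈ᶜ A) ≐ (_∈ᶜ C)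

  ∈ᶜ-resp : ∀ A {x z} → x ≈ˣ z → x ∈ᶜ A → z ∈ᶜ A
  ∈ᶜ-resp (_ , inj₁ (u , to , from) , _) e r =
    from (λ y u∥y → ∥-resp e (Setoid.refl Y) (to r y u∥y))
  ∈ᶜ-resp (_ , inj₂ empty , _) {x} e r with () ← empty x r

  module Space = Topology X _∋ᶜ_

record Frame (ℓ : Level) : Set (suc ℓ) where
  field
    polarity : Polarity ℓ
  open Polarity polarity public
  infix 4 _S_ _I_ _S′_
  field
    _S_      : ∣Y∣ → ∣X∣ → Set ℓ
    S-resp   : ∀ {x x′ y y′} → y ≈ʸ y′ → x ≈ˣ x′ → y S x → y′ S x′

  module GX = Galois polarity
  module GY = Galois (dual polarity)

  _I_ : ∣X∣ → ∣Y∣ → Set ℓ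
  x I y = ¬ (x ∥ y)

  _S′_ : Rel ∣X∣ ℓ
  z S′ x = ∀ y → y S x → z ∥ y

record IsSRFSide (P : Polarity ℓ) : Set (suc ℓ) where
  open Polarity P
  open Galois P
  field
    nonempty      : ∣X∣
    quasi-serial  : ∀ x → ∃[ y ] ¬ (x ∥ y)
    separated     : IsPartialOrder _≈ˣ_ _⪯_
    X-clopen      : IsClopen {0ℓ} U
    ∩-clopen      : ∀ A C → IsClopen ((_∈ᶜ A) ∩ (_∈ᶜ C))
    closed⇒⋂      : ∀ (C : Pred ∣X∣ ℓ) → Closed C →
                    Σ[ I ∈ Set ℓ ] Σ[ A ∈ (I → Clopen) ] C ≐ ⋂ I (λ i → _∈ᶜ A i)
    ⋂⇒closed      : ∀ {I : Set ℓ} (A : I → Clopen) → Closed (⋂ I (λ i → _∈ᶜ A i))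
    spectral      : Space.IsSpectral

record IsSRF (𝔉 : Frame ℓ) : Set (suc ℓ) where
  open Frame 𝔉
  field
    sideX         : IsSRFSide polarity
    sideY         : IsSRFSide (dual polarity)
    S-closed      : ∀ x → GY.Closed (_S x)
    S-clopen      : ∀ x → GX.IsClopen (GX.Γ x) → GY.IsClopen (_S x)
    S-down        : ∀ y {x z} → z GX.⪯ x → y S x → y S z
    S′-stableˡ    : ∀ x → GX.Stable (_S′ x)
    S′-stableʳ    : ∀ z → GX.Stable (z S′_)
    -- The axioms above constrain ∥ and S only at points generating clopen
    -- elements.  For instance, a pair of a non-principal filter and a
    -- non-principal ideal may be added to ∥ in some canonical frames, or
    -- S x may be emptied at a non-principal maximal filter x, without
    -- violating any of them or changing the clopen elements; such a frame
    -- is not isomorphic to a canonical one.  The next two determine ∥ and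
    -- S by their restrictions to those points.
    ∥-open        : ∀ y → GX.Space.OpenSet (_∥ y)
    S-closedˢ     : ∀ y → GX.Space.ClosedSet (y S_)

record FrameMap (𝔉₂ 𝔉₁ : Frame ℓ) : Set ℓ where
  private
    module 𝔉₁ = Frame 𝔉₁
    module 𝔉₂ = Frame 𝔉₂
  field
    p : Func 𝔉₂.X 𝔉₁.X
    q : Func 𝔉₂.Y 𝔉₁.Y
  open Func p public using () renaming (to to p₀; cong to p-cong)
  open Func q public using () renaming (to to q₀; cong to q-cong)

record IsSRFMorphism {𝔉₂ 𝔉₁ : Frame ℓ} (π : FrameMap 𝔉₂ 𝔉₁) : Set ℓ where
  private
    module 𝔉₁ = Frame 𝔉₁
    module 𝔉₂ = Frame 𝔉₂
  open FrameMap π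
  field
    I-forth   : ∀ {x′ y′} → x′ 𝔉₂.I y′ → p₀ x′ 𝔉₁.I q₀ y′
    I-backˣ   : ∀ {x y′} → x 𝔉₁.I q₀ y′ → ∃[ x′ ] x 𝔉₁.GX.⪯ p₀ x′ × x′ 𝔉₂.I y′
    I-backʸ   : ∀ {x′ y} → p₀ x′ 𝔉₁.I y → ∃[ y′ ] y 𝔉₁.GY.⪯ q₀ y′ × x′ 𝔉₂.I y′
    -- From left to right alone, the preimage map would only be lax with
    -- respect to the quasi-complements; the converse amounts to
    -- v S₂ x → q v S₁ p x.
    S-iff     : ∀ {v z} → (q₀ v 𝔉₁.S z) ⇔ (∃[ x ] z 𝔉₁.GX.⪯ p₀ x × v 𝔉₂.S x)
    -- The preimage of Γ u may be empty: for the map induced by a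
    -- homomorphism h it is so when h[u] generates an improper filter.
    p-closed  : ∀ u → 𝔉₂.GX.Closed (𝔉₁.GX.Γ u ∘ p₀)
    q-closed  : ∀ u → 𝔉₂.GY.Closed (𝔉₁.GY.Γ u ∘ q₀)

private
  module GaloisMono (P Q : Polarity ℓ) (f : Polarity.∣X∣ P → Polarity.∣X∣ Q)
                    (pre : ∀ u → Galois.Closed P (Galois.Γ Q u ∘ f)) where
    module P = Galois P
    module Q = Galois Q

    mono : ∀ {x z} → x P.⪯ z → f x Q.⪯ f z
    mono {x} {z} x⪯z with pre (f x)
    ... | inj₁ (v , to , from) = from (λ y v∥y → x⪯z y (to {x} (λ _ r → r) y v∥y))
    ... | inj₂ e with () ← e x (λ _ r → r)

  closed-∘ : ∀ (P Q : Polarity ℓ) (f : Polarity.∣X∣ P → Polarity.∣X∣ Q) →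
             (∀ u → Galois.Closed P (Galois.Γ Q u ∘ f)) →
             ∀ {A : Pred (Polarity.∣X∣ Q) ℓ} → Galois.Closed Q A → Galois.Closed P (A ∘ f)
  closed-∘ P Q f pre (inj₂ e) = inj₂ (λ x → e (f x))
  closed-∘ P Q f pre (inj₁ (u , A⊆Γ , Γ⊆A)) with pre u
  ... | inj₁ (v , to , from) = inj₁ (v , (λ r → to (A⊆Γ r)) , (λ r → Γ⊆A (from r)))
  ... | inj₂ e = inj₂ (λ x r → e x (A⊆Γ r))

idMap : (𝔉 : Frame ℓ) → FrameMap 𝔉 𝔉
idMap 𝔉 = record { p = Id.function X ; q = Id.function Y }
  where open Frame 𝔉

_∘M_ : {𝔉₃ 𝔉₂ 𝔉₁ : Frame ℓ} → FrameMap 𝔉₂ 𝔉₁ → FrameMap 𝔉₃ 𝔉₂ → FrameMap 𝔉₃ 𝔉₁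
π ∘M ρ = record { p = Comp.function ρ.p π.p ; q = Comp.function ρ.q π.q }
  where
  module π = FrameMap π
  module ρ = FrameMap ρ

id-isMorphism : (𝔉 : Frame ℓ) → IsSRF 𝔉 → IsSRFMorphism (idMap 𝔉)
id-isMorphism 𝔉 ax = record
  { I-forth  = λ r → r
  ; I-backˣ  = λ {x} r → x , (λ _ s → s) , r
  ; I-backʸ  = λ {_} {y} r → y , (λ _ s → s) , r
  ; S-iff   = λ {v} {z} → mk⇔ (λ r → z , (λ _ s → s) , r) (λ (_ , z⪯x , r) → S-down v z⪯x r)
  ; p-closed = λ u → inj₁ (u , (λ r → r) , (λ r → r))
  ; q-closed = λ u → inj₁ (u , (λ r → r) , (λ r → r))
  }
  where
  open Frame 𝔉
  open IsSRF ax

∘-isMorphism : {𝔉₃ 𝔉₂ 𝔉₁ : Frame ℓ} {π : FrameMap 𝔉₂ 𝔉₁} {ρ : FrameMap 𝔉₃ 𝔉₂} →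
               IsSRFMorphism π → IsSRFMorphism ρ → IsSRFMorphism (π ∘M ρ)
∘-isMorphism {𝔉₃ = 𝔉₃} {𝔉₂} {𝔉₁} {π} {ρ} mπ mρ = record
  { I-forth  = λ r → π.I-forth (ρ.I-forth r)
  ; I-backˣ  = λ r → let (x₁ , le₁ , r₁) = π.I-backˣ r
                         (x₂ , le₂ , r₂) = ρ.I-backˣ r₁
                     in x₂ , (λ y s → MX.mono le₂ y (le₁ y s)) , r₂
  ; I-backʸ  = λ r → let (y₁ , le₁ , r₁) = π.I-backʸ r
                         (y₂ , le₂ , r₂) = ρ.I-backʸ r₁
                     in y₂ , (λ x s → MY.mono le₂ x (le₁ x s)) , r₂
  ; S-iff   = mk⇔
      (λ r → let (x₁ , le₁ , r₁) = Equivalence.to π.S-iff r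
                 (x₂ , le₂ , r₂) = Equivalence.to ρ.S-iff r₁
             in x₂ , (λ y s → MX.mono le₂ y (le₁ y s)) , r₂)
      (λ (x₂ , le , r) → Equivalence.from π.S-iff
         (FrameMap.p₀ ρ x₂ , le , Equivalence.from ρ.S-iff (x₂ , (λ _ s → s) , r)))
  ; p-closed = λ u → closed-∘ 𝔉₃.polarity 𝔉₂.polarity (FrameMap.p₀ ρ) ρ.p-closed (π.p-closed u)
  ; q-closed = λ u → closed-∘ (dual 𝔉₃.polarity) (dual 𝔉₂.polarity) (FrameMap.q₀ ρ)
                       ρ.q-closed (π.q-closed u)
  }
  where
  module 𝔉₁ = Frame 𝔉₁
  module 𝔉₂ = Frame 𝔉₂
  module 𝔉₃ = Frame 𝔉₃
  module π = IsSRFMorphism mπ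
  module ρ = IsSRFMorphism mρ
  module MX = GaloisMono 𝔉₂.polarity 𝔉₁.polarity (FrameMap.p₀ π) π.p-closed
  module MY = GaloisMono (dual 𝔉₂.polarity) (dual 𝔉₁.polarity) (FrameMap.q₀ π) π.q-closed

infix 4 _≈M_
_≈M_ : {𝔉₂ 𝔉₁ : Frame ℓ} → Rel (FrameMap 𝔉₂ 𝔉₁) ℓ
_≈M_ {𝔉₁ = 𝔉₁} π ρ = (∀ x → p₀ π x ≈ˣ p₀ ρ x) × (∀ y → q₀ π y ≈ʸ q₀ ρ y)
  where
  open Frame 𝔉₁
  open FrameMap

≈M-refl : {𝔉₂ 𝔉₁ : Frame ℓ} {π : FrameMap 𝔉₂ 𝔉₁} → π ≈M π
≈M-refl {𝔉₁ = 𝔉₁} = (λ _ → Setoid.refl X) , (λ _ → Setoid.refl Y)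
  where open Frame 𝔉₁

≈M-sym : {𝔉₂ 𝔉₁ : Frame ℓ} {π ρ : FrameMap 𝔉₂ 𝔉₁} → π ≈M ρ → ρ ≈M π
≈M-sym {𝔉₁ = 𝔉₁} (a , b) = (λ x → Setoid.sym X (a x)) , (λ y → Setoid.sym Y (b y))
  where open Frame 𝔉₁

≈M-trans : {𝔉₂ 𝔉₁ : Frame ℓ} {π ρ σ : FrameMap 𝔉₂ 𝔉₁} → π ≈M ρ → ρ ≈M σ → π ≈M σ
≈M-trans {𝔉₁ = 𝔉₁} (a , b) (c , d) =
  (λ x → Setoid.trans X (a x) (c x)) , (λ y → Setoid.trans Y (b y) (d y))
  where open Frame 𝔉₁

∘M-cong : {𝔉₃ 𝔉₂ 𝔉₁ : Frame ℓ} {π π′ : FrameMap 𝔉₂ 𝔉₁} {ρ ρ′ : FrameMap 𝔉₃ 𝔉₂} →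
          π ≈M π′ → ρ ≈M ρ′ → (π ∘M ρ) ≈M (π′ ∘M ρ′)
∘M-cong {𝔉₁ = 𝔉₁} {π = π} {ρ′ = ρ′} (a , b) (c , d) =
  (λ x → Setoid.trans X (FrameMap.p-cong π (c x)) (a (FrameMap.p₀ ρ′ x))) ,
  (λ y → Setoid.trans Y (FrameMap.q-cong π (d y)) (b (FrameMap.q₀ ρ′ y)))
  where open Frame 𝔉₁

𝐒𝐑𝐅* : ∀ ℓ → Category (suc ℓ) ℓ ℓ
𝐒𝐑𝐅* ℓ = record
  { Obj       = Σ (Frame ℓ) IsSRF
  ; _⇒_       = λ (𝔉₂ , _) (𝔉₁ , _) → Σ (FrameMap 𝔉₂ 𝔉₁) IsSRFMorphism
  ; _≈_       = λ (π , _) (ρ , _) → π ≈M ρ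
  ; id        = λ {(𝔉 , ax)} → idMap 𝔉 , id-isMorphism 𝔉 ax
  ; _∙_       = λ (π , mπ) (ρ , mρ) → (π ∘M ρ) , ∘-isMorphism mπ mρ
  ; ≈-equiv   = λ {(𝔉₂ , _)} {(𝔉₁ , _)} → record
      { refl  = λ {(π , _)} → ≈M-refl {π = π}
      ; sym   = λ {(π , _)} {(ρ , _)} → ≈M-sym {π = π} {ρ}
      ; trans = λ {(π , _)} {(ρ , _)} {(σ , _)} → ≈M-trans {π = π} {ρ} {σ} }
  ; ∙-cong    = λ {_} {_} {_} {(π , _)} {(π′ , _)} {(ρ , _)} {(ρ′ , _)} →
                  ∘M-cong {π = π} {π′} {ρ} {ρ′}
  ; identityˡ = λ (π , _) → ≈M-refl {π = π}
  ; identityʳ = λ (π , _) → ≈M-refl {π = π}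
  ; assoc     = λ (π , _) (ρ , _) (σ , _) → ≈M-refl {π = π ∘M (ρ ∘M σ)}
  }

module _ (L : QLattice ℓ) where
  open QLattice L

  record Filter : Set ℓ where
    field
      mem      : Carrier → Bool
      ⊤-mem    : ⟦ mem ⟧ ⊤
      up       : ∀ {a b} → a ≤ b → ⟦ mem ⟧ a → ⟦ mem ⟧ b
      ∧-mem    : ∀ {a b} → ⟦ mem ⟧ a → ⟦ mem ⟧ b → ⟦ mem ⟧ (a ∧ b)
      proper   : ¬ ⟦ mem ⟧ ⊥

  record Ideal : Set ℓ where
    field
      mem      : Carrier → Bool
      ⊥-mem    : ⟦ mem ⟧ ⊥
      down     : ∀ {a b} → a ≤ b → ⟦ mem ⟧ b → ⟦ mem ⟧ a
      ∨-mem    : ∀ {a b} → ⟦ mem ⟧ a → ⟦ mem ⟧ b → ⟦ mem ⟧ (a ∨ b)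
      proper   : ¬ ⟦ mem ⟧ ⊤

  infix 4 _∈ᶠ_ _∈ⁱ_
  _∈ᶠ_ : Carrier → Filter → Set
  a ∈ᶠ x = ⟦ Filter.mem x ⟧ a

  _∈ⁱ_ : Carrier → Ideal → Set
  a ∈ⁱ y = ⟦ Ideal.mem y ⟧ a

  -- The ideal generated by P; it may be improper.

  Generated : Pred Carrier l → Pred Carrier (ℓ ⊔ l)
  Generated P b = ∃[ as ] All P as × b ≤ foldr _∨_ ⊥ as

  ν[_] : Filter → Pred Carrier ℓ
  ν[ x ] b = ∃[ a ] a ∈ᶠ x × b ≈ ν a

  filters : Setoid ℓ ℓ
  filters = record
    { Carrier = Filter
    ; _≈_ = λ x z → (_∈ᶠ x) ≐ (_∈ᶠ z)
    ; isEquivalence = record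
        { refl  = (λ r → r) , (λ r → r)
        ; sym   = λ (f , g) → g , f
        ; trans = λ (f , g) (h , k) → (λ r → h (f r)) , (λ r → g (k r)) } }

  ideals : Setoid ℓ ℓ
  ideals = record
    { Carrier = Ideal
    ; _≈_ = λ y w → (_∈ⁱ y) ≐ (_∈ⁱ w)
    ; isEquivalence = record
        { refl  = (λ r → r) , (λ r → r)
        ; sym   = λ (f , g) → g , f
        ; trans = λ (f , g) (h , k) → (λ r → h (f r)) , (λ r → g (k r)) } }

  canonicalFrame : Frame ℓ
  canonicalFrame = record
    { polarity = record
        { X = filters ; Y = ideals
        ; _∥_ = λ x y → (_∈ᶠ x) ≬ (_∈ⁱ y)
        ; ∥-resp = λ (f , _) (g , _) (a , a∈x , a∈y) → a , f a∈x , g a∈y }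
    ; _S_ = λ y x → Generated ν[ x ] ⊆ (_∈ⁱ y)
    ; S-resp = λ (g , _) (_ , f) r (as , ps , b≤) →
                 g (r (as , All.map (λ (a , a∈ , eq) → a , f a∈ , eq) ps , b≤)) }

module _ {K L : QLattice ℓ} (h : QHom K L) where
  private
    module K = QLattice K
    module L = QLattice L
  open QHom h

  preFilter : Filter L → Filter K
  preFilter x = record
    { mem    = mem ∘ to
    ; ⊤-mem  = up (L.reflexive (L.Eq.sym ⊤-homo)) ⊤-mem
    ; up     = λ a≤b → up (mono a≤b)
    ; ∧-mem  = λ {a} {b} r s → up (L.reflexive (L.Eq.sym (∧-homo a b))) (∧-mem r s)
    ; proper = λ r → proper (up (L.reflexive ⊥-homo) r)
    } where open Filter x

  preIdeal : Ideal L → Ideal K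
  preIdeal y = record
    { mem    = mem ∘ to
    ; ⊥-mem  = down (L.reflexive ⊥-homo) ⊥-mem
    ; down   = λ a≤b → down (mono a≤b)
    ; ∨-mem  = λ {a} {b} r s → down (L.reflexive (∨-homo a b)) (∨-mem r s)
    ; proper = λ r → proper (down (L.reflexive (L.Eq.sym ⊤-homo)) r)
    } where open Ideal y

  canonicalMap : FrameMap (canonicalFrame L) (canonicalFrame K)
  canonicalMap = record
    { p = record { to = preFilter ; cong = λ (f , g) → f , g }
    ; q = record { to = preIdeal  ; cong = λ (f , g) → f , g } }

canonicalMap-cong : {K L : QLattice ℓ} {f g : QHom K L} →
                    (∀ a → QLattice._≈_ L (QHom.to f a) (QHom.to g a)) →
                    canonicalMap f ≈M canonicalMap g
canonicalMap-cong {L = L} e =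
  (λ x → (λ {a} → Filter.up x (reflexive (e a))) ,
         (λ {a} → Filter.up x (reflexive (Eq.sym (e a))))) ,
  (λ y → (λ {a} → Ideal.down y (reflexive (Eq.sym (e a)))) ,
         (λ {a} → Ideal.down y (reflexive (e a))))
  where open QLattice L

record 𝙵-WellDefined (ℓ : Level) : Set (suc ℓ) where
  field
    object   : (L : QLattice ℓ) → IsSRF (canonicalFrame L)
    morphism : {K L : QLattice ℓ} (h : QHom K L) → IsSRFMorphism (canonicalMap h)

𝙵 : 𝙵-WellDefined ℓ → Functor (𝐌 ℓ) (op (𝐒𝐑𝐅* ℓ))
𝙵 wd = record
  { F₀     = λ L → canonicalFrame L , object L
  ; F₁     = λ h → canonicalMap h , morphism h
  ; F-cong = λ {K} {L} {f} {g} → canonicalMap-cong {f = f} {g}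
  ; F-id   = (λ _ → (λ r → r) , (λ r → r)) , (λ _ → (λ r → r) , (λ r → r))
  ; F-∙    = λ _ _ → (λ _ → (λ r → r) , (λ r → r)) , (λ _ → (λ r → r) , (λ r → r))
  }
  where open 𝙵-WellDefined wd

module ClopenOps (em : ExcludedMiddle ℓ) (𝔉 : Frame ℓ) where
  open Frame 𝔉
  open GX

  meet join : (A C : Clopen) → ∣X∣ → Bool
  meet A C x = proj₁ A x ∧ᵇ proj₁ C x
  join A C = ⌊ (((_∈ᶜ A) ∪ (_∈ᶜ C)) ▹) ◃ ⌋[ em ]

  top bot : ∣X∣ → Bool
  top _ = true
  bot _ = false

  star : Clopen → ∣X∣ → Bool
  star A = ⌊ (λ x → ∀ z → z ∈ᶜ A → x S′ z) ⌋[ em ]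

record ClopenClosed (em : ExcludedMiddle ℓ) (𝔉 : Frame ℓ) : Set ℓ where
  open Frame 𝔉
  open GX
  open ClopenOps em 𝔉
  field
    meet-clopen : ∀ A C → IsClopen ⟦ meet A C ⟧
    join-clopen : ∀ A C → IsClopen ⟦ join A C ⟧
    top-clopen  : IsClopen ⟦ top ⟧
    bot-clopen  : IsClopen ⟦ bot ⟧
    star-clopen : ∀ A → IsClopen ⟦ star A ⟧

  infixr 6 _∨ᶜ_
  infixr 7 _∧ᶜ_
  infix  8 _*
  _∧ᶜ_ _∨ᶜ_ : Clopen → Clopen → Clopen
  A ∧ᶜ C = meet A C , meet-clopen A C
  A ∨ᶜ C = join A C , join-clopen A C

  ⊤ᶜ ⊥ᶜ : Clopen
  ⊤ᶜ = top , top-clopen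
  ⊥ᶜ = bot , bot-clopen

  _* : Clopen → Clopen
  A * = star A , star-clopen A

record IsClopenAlgebra (em : ExcludedMiddle ℓ) (𝔉 : Frame ℓ) : Set ℓ where
  open Frame 𝔉
  open GX
  field
    clopenClosed : ClopenClosed em 𝔉
  open ClopenClosed clopenClosed public
  field
    isBoundedLattice : IsBoundedLattice _≈ᶜ_ _⊆ᶜ_ _∨ᶜ_ _∧ᶜ_ ⊤ᶜ ⊥ᶜ
    *-antitone       : ∀ {A C} → A ⊆ᶜ C → C * ⊆ᶜ A *
    *-⊥              : ⊥ᶜ * ≈ᶜ ⊤ᶜ
    *-∨              : ∀ A C → (A ∨ᶜ C) * ≈ᶜ (A *) ∧ᶜ (C *)
    ⊥≉⊤              : ¬ (⊥ᶜ ≈ᶜ ⊤ᶜ)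

  clopenAlgebra : QLattice ℓ
  clopenAlgebra = record
    { boundedLattice = record { isBoundedLattice = isBoundedLattice }
    ; ν = _* ; ν-antitone = λ {A} {C} → *-antitone {A} {C}
    ; ν-⊥ = *-⊥ ; ν-∨ = *-∨ ; ⊥≉⊤ = ⊥≉⊤ }

module _ {𝔉₂ 𝔉₁ : Frame ℓ} (π : FrameMap 𝔉₂ 𝔉₁) where
  private
    module 𝔉₁ = Frame 𝔉₁
    module 𝔉₂ = Frame 𝔉₂
  open FrameMap π
  open 𝔉₂.GX using (_≈ᶜ_)

  PreservesClopen : Set ℓ
  PreservesClopen = (A : 𝔉₁.GX.Clopen) → 𝔉₂.GX.IsClopen ⟦ proj₁ A ∘ p₀ ⟧

  pre : PreservesClopen → 𝔉₁.GX.Clopen → 𝔉₂.GX.Clopen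
  pre pc A = proj₁ A ∘ p₀ , pc A

  record IsClopenHom {em : ExcludedMiddle ℓ}
           (alg₂ : IsClopenAlgebra em 𝔉₂) (alg₁ : IsClopenAlgebra em 𝔉₁) : Set ℓ where
    private
      module A₁ = IsClopenAlgebra alg₁
      module A₂ = IsClopenAlgebra alg₂
    field
      pc    : PreservesClopen
      pre-∨ : ∀ A C → pre pc (A A₁.∨ᶜ C) ≈ᶜ pre pc A A₂.∨ᶜ pre pc C
      pre-∧ : ∀ A C → pre pc (A A₁.∧ᶜ C) ≈ᶜ pre pc A A₂.∧ᶜ pre pc C
      pre-⊥ : pre pc A₁.⊥ᶜ ≈ᶜ A₂.⊥ᶜ
      pre-⊤ : pre pc A₁.⊤ᶜ ≈ᶜ A₂.⊤ᶜ
      pre-* : ∀ A → pre pc (A A₁.*) ≈ᶜ (pre pc A) A₂.*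

    preHom : QHom A₁.clopenAlgebra A₂.clopenAlgebra
    preHom = record
      { func = record { to = pre pc ; cong = λ (f , g) → f , g }
      ; ∨-homo = pre-∨ ; ∧-homo = pre-∧ ; ⊥-homo = pre-⊥ ; ⊤-homo = pre-⊤ ; ν-homo = pre-* }

record 𝙻*-WellDefined (em : ExcludedMiddle ℓ) : Set (suc ℓ) where
  field
    object   : (𝔉 : Frame ℓ) → IsSRF 𝔉 → IsClopenAlgebra em 𝔉
    morphism : {𝔉₂ 𝔉₁ : Frame ℓ} (ax₂ : IsSRF 𝔉₂) (ax₁ : IsSRF 𝔉₁) (π : FrameMap 𝔉₂ 𝔉₁) →
               IsSRFMorphism π → IsClopenHom π (object 𝔉₂ ax₂) (object 𝔉₁ ax₁)

𝙻* : (em : ExcludedMiddle ℓ) → 𝙻*-WellDefined em → Functor (op (𝐒𝐑𝐅* ℓ)) (𝐌 ℓ)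
𝙻* em wd = record
  { F₀     = λ (𝔉 , ax) → IsClopenAlgebra.clopenAlgebra (object 𝔉 ax)
  ; F₁     = λ {(_ , ax₁)} {(_ , ax₂)} (π , mπ) → IsClopenHom.preHom (morphism ax₂ ax₁ π mπ)
  ; F-cong = λ {(𝔉 , _)} (e , _) A →
      (λ {x} → Frame.GX.∈ᶜ-resp 𝔉 A (e x)) ,
      (λ {x} → Frame.GX.∈ᶜ-resp 𝔉 A (Setoid.sym (Frame.X 𝔉) (e x)))
  ; F-id   = λ _ → (λ r → r) , (λ r → r)
  ; F-∙    = λ _ _ _ → (λ r → r) , (λ r → r)
  }
  where open 𝙻*-WellDefined wd

{-# OPTIONS --safe #-}
module Submission where

-- Up to the improper ones, the clopen elements of a canonical frame are the
-- sets of proper filters containing a given element, so a ↦ X_a is an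
-- isomorphism.  A nonempty clopen element has a least point, hence is compact,
-- and the compact open sets are the finite unions of clopen elements.
-- Conversely, in an SRF frame the points z such that every clopen element
-- containing z belongs to a given proper filter F of clopen elements form an
-- irreducible closed set.  Sobriety gives it a generic point, whose clopen
-- neighbourhoods are precisely the members of F; this replaces any choice of
-- points.  Ideals correspond to points of Y in the same way, because A ↦ A▹ is
-- a dual isomorphism between the clopen elements of X and those of Y.

open import Defs
open import Level using (Level; suc; _⊔_; 0ℓ; Lift; lift; lower)
open import Algebra.Core using (Op₂)
open import Axiom.DoubleNegationElimination using (em⇒dne)
open import Axiom.ExcludedMiddle using (ExcludedMiddle)
open import Data.Bool.Base using (Bool; true; false) renaming (_∧_ to _∧ᵇ_)
open import Data.Bool.Properties using (T-∧)
open import Data.Empty using (⊥-elim)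
open import Data.List.Base using (List; []; _∷_; _++_; foldr)
open import Data.List.Relation.Unary.All as All using (All; []; _∷_)
open import Data.List.Relation.Unary.All.Properties as All using ()
open import Data.List.Relation.Unary.Any as Any using (Any; here; there)
open import Data.List.Relation.Unary.Any.Properties as Any using ()
open import Data.Product.Base as Product using (∃-syntax; Σ-syntax; _×_; _,_; proj₁; proj₂)
open import Data.Sum.Base as Sum using (_⊎_; inj₁; inj₂)
open import Data.Unit.Base using (tt)
import Data.Unit.Polymorphic.Base as Unit
open import Function.Base using (_∘_; flip)
open import Function.Bundles using (_⇔_; mk⇔; module Equivalence)
open import Relation.Binary.Bundles using (Setoid)
open import Relation.Binary.Core using (Rel)
open import Relation.Binary.Lattice.Bundles using (BoundedLattice)
import Relation.Binary.Lattice.Properties.JoinSemilattice as JoinSemilattice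
import Relation.Binary.Lattice.Properties.MeetSemilattice as MeetSemilattice
open import Relation.Binary.Structures using (IsPartialOrder)
import Relation.Binary.Construct.Flip.EqAndOrd as Flip
open import Relation.Binary.PropositionalEquality.Core as ≡ using (_≡_)
open import Relation.Nullary.Decidable.Core using (yes; no; toSum; decidable-stable; T?)
open import Relation.Nullary.Negation.Core using (¬_; contradiction)
open import Relation.Unary
  using (Pred; _⊆_; _≐_; ∁; _∪_; _∩_; ⋂; _≬_; U)

-- The lattices need not be distributive, so nothing is separated by prime filters. Every separation
-- argument tests against a principal filter or a principal ideal, which is written down outright.
-- The price is paid at the bounds: the principal filter of an element below `⊥` and the principal
-- ideal of an element above `⊤` are improper, hence not points, and many case distinctions below
-- exist only to handle them. `X` and `Y` are treated by one argument over an abstract polarity and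
-- lattice, instantiated a second time at their duals. On the frame side, `∥-open` and `S-closedˢ`
-- express `∥` and `S` through clopen elements; the comparison map therefore preserves and reflects
-- both relations, and the morphism conditions for it and its inverse become automatic. Excluded
-- middle decides whether a generated filter is proper, turns predicates into characteristic
-- functions and allows arguments by contradiction.

private
  variable
    ℓ l l′ : Level

-- Classical preliminaries on predicates

⌊⌋-≐ : {A : Set ℓ} (em : ExcludedMiddle ℓ) (P : Pred A ℓ) → P ≐ ⟦ ⌊ P ⌋[ em ] ⟧
⌊⌋-≐ em P = (λ {x} → to {x}) , (λ {x} → from {x})
  where
  to : P ⊆ ⟦ ⌊ P ⌋[ em ] ⟧
  to {x} r with em {P x}
  ... | yes _ = tt
  ... | no ¬r = contradiction r ¬r
  from : ⟦ ⌊ P ⌋[ em ] ⟧ ⊆ P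
  from {x} r with em {P x}
  ... | yes p = p

∁-⊈ : ExcludedMiddle ℓ → {A : Set ℓ} {P : Pred A ℓ} {Q : Pred A ℓ} → ¬ (P ⊆ Q) → ∃[ x ] P x × ¬ Q x
∁-⊈ em ¬P⊆Q with em
... | yes r = r
... | no ¬r = contradiction (λ {x} px → em⇒dne em (λ ¬qx → ¬r (x , px , ¬qx))) ¬P⊆Q

-- Compact open sets over a basis of compact sets

module CompactBasis {ℓ} (X : Setoid ℓ ℓ) {B : Set ℓ} (basic : B → Pred (Setoid.Carrier X) 0ℓ) where
  open Setoid X renaming (Carrier to ∣X∣)
  open Topology X basic

  basic-open : ∀ b → OpenSet (Lift ℓ ∘ basic b)
  basic-open b (lift r) = b , r , lift

  Compact-resp-≐ : {K : Pred ∣X∣ l} {N : Pred ∣X∣ l′} → K ≐ N → Compact K → Compact N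
  Compact-resp-≐ (K⊆N , N⊆K) cK V oV cover =
    Product.map₂ (λ c n → c (N⊆K n)) (cK V oV (λ k → cover (K⊆N k)))

  Any-compact : {J : Set l} (P : J → Pred ∣X∣ l′) → (∀ j → Compact (P j)) →
                ∀ js → Compact (λ x → Any (λ j → P j x) js)
  Any-compact P cP []       V oV cover = [] , λ ()
  Any-compact P cP (j ∷ js) V oV cover =
    let (is₁ , c₁) = cP j V oV (λ r → cover (here r))
        (is₂ , c₂) = Any-compact P cP js V oV (λ r → cover (there r))
    in is₁ ++ is₂ , λ { (here r) → Any.++⁺ˡ (c₁ r) ; (there r) → Any.++⁺ʳ is₁ (c₂ r) }

  -- Compactness is applied to the cover by all basic sets inside `K`. The index carries the
  -- inclusion proof, so the finite subcover also stays within `K`.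
  compactOpen-Any : ∀ {K} → OpenSet K → Compact K →
                    ∃[ bs ] K ≐ (λ x → Any (λ ((b , _) : Σ[ b ∈ B ] basic b ⊆ K) → basic b x) bs)
  compactOpen-Any oK cK =
    let (bs , c) = cK {I = Σ[ b ∈ B ] basic b ⊆ _} (λ (b , _) → Lift ℓ ∘ basic b)
                      (λ (b , _) → basic-open b)
                      (λ k → let (b , r , b⊆K) = oK k in (b , b⊆K) , lift r)
    in bs , (λ k → Any.map lower (c k)) ,
            (λ r → let ((_ , b⊆K) , r′) = Any.satisfied r in b⊆K r′)

  module _ (basic-compact : ∀ b → Compact (basic b))
           (∩-basic : ∀ b c → ∃[ d ] basic d ≐ basic b ∩ basic c) where

    -- Intersection distributes over the two finite unions of basic sets, and each
    -- `basic b ∩ basic c` is again basic.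
    ∩-compact : ∀ K N → OpenSet K → Compact K → OpenSet N → Compact N → Compact (K ∩ N)
    ∩-compact K N oK cK oN cN =
      let (bs , K⊆ , ⊆K) = compactOpen-Any oK cK
          (cs , N⊆ , ⊆N) = compactOpen-Any oN cN
      in Compact-resp-≐
           ( (λ r → ⊆K (Any.map (λ s → proj₁ (proj₂ (Any.satisfied s))) r)
                  , ⊆N (Any.map proj₂ (proj₂ (Any.satisfied r))))
           , (λ (k , n) → Any.map (λ bx → Any.map (λ cx → bx , cx) (N⊆ n)) (K⊆ k)) )
           (Any-compact (λ b x → Any (λ c → (basic (proj₁ b) ∩ basic (proj₁ c)) x) cs)
             (λ b → Any-compact (λ c → basic (proj₁ b) ∩ basic (proj₁ c))
               (λ c → let (d , e) = ∩-basic (proj₁ b) (proj₁ c)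
                      in Compact-resp-≐ e (basic-compact d)) cs) bs)

    basic-neighbourhood : ∀ V → OpenSet V → ∀ {x} → V x →
                          ∃[ K ] OpenSet K × Compact K × K x × K ⊆ V
    basic-neighbourhood V oV vx =
      let (b , r , b⊆V) = oV vx
      in Lift ℓ ∘ basic b , basic-open b , Compact-resp-≐ (lift , lower) (basic-compact b)
       , lift r , (λ (lift s) → b⊆V s)

-- Closed, open and clopen elements of a polarity

module GaloisProperties (P : Polarity ℓ) where
  open Polarity P
  open Galois P
  private module Gᵒ = Galois (dual P)

  ⪯-refl : ∀ {x} → x ⪯ x
  ⪯-refl _ r = r

  ⪯-trans : ∀ {x y z} → x ⪯ y → y ⪯ z → x ⪯ z
  ⪯-trans f g y r = g y (f y r)

  ≈⇒⪯ : ∀ {x z} → x ≈ˣ z → x ⪯ z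
  ≈⇒⪯ e y = ∥-resp e (Setoid.refl Y)

  ▹◃-extensive : (A : Pred ∣X∣ l) → A ⊆ (A ▹) ◃
  ▹◃-extensive A r y s = s _ r

  ◃-stable : (B : Pred ∣Y∣ l) → Stable (B ◃)
  ◃-stable B = ▹◃-extensive (B ◃) , λ r y b → r y (λ x s → s y b)

  Closed-resp-≐ : {A : Pred ∣X∣ l} {C : Pred ∣X∣ l′} → A ≐ C → Closed A → Closed C
  Closed-resp-≐ (A⊆C , C⊆A) (inj₁ (x , A⊆Γ , Γ⊆A)) = inj₁ (x , (λ c → A⊆Γ (C⊆A c)) , (λ r → A⊆C (Γ⊆A r)))
  Closed-resp-≐ (A⊆C , C⊆A) (inj₂ e) = inj₂ (λ x c → e x (C⊆A c))

  Open-resp-≐ : {A : Pred ∣X∣ l} {C : Pred ∣X∣ l′} → A ≐ C → Open A → Open C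
  Open-resp-≐ (A⊆C , C⊆A) (inj₁ (y , A⊆y , y⊆A)) = inj₁ (y , (λ c → A⊆y (C⊆A c)) , (λ r → A⊆C (y⊆A r)))
  Open-resp-≐ (A⊆C , C⊆A) (inj₂ u) = inj₂ (λ x → A⊆C (u x))

  IsClopen-resp-≐ : {A : Pred ∣X∣ l} {C : Pred ∣X∣ l′} → A ≐ C → IsClopen A → IsClopen C
  IsClopen-resp-≐ e (c , o) = Closed-resp-≐ e c , Open-resp-≐ e o

  Closed-upward : {A : Pred ∣X∣ l} → Closed A → ∀ {x z} → x ⪯ z → A x → A z
  Closed-upward (inj₁ (u , A⊆Γ , Γ⊆A)) x⪯z r = Γ⊆A (⪯-trans (A⊆Γ r) x⪯z)
  Closed-upward (inj₂ e) x⪯z r = contradiction r (e _)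

  Clopen-upward : ∀ A {x z} → x ⪯ z → x ∈ᶜ A → z ∈ᶜ A
  Clopen-upward (_ , c , _) = Closed-upward c

  Open-stable : {A : Pred ∣X∣ l} → Open A → Stable A
  Open-stable (inj₁ (y , A⊆y , y⊆A)) = ▹◃-extensive _ , λ r → y⊆A (r y (λ x → A⊆y))
  Open-stable (inj₂ u) = ▹◃-extensive _ , λ {x} _ → u x

  ⌊_⌋ᶜ : {A : Pred ∣X∣ ℓ} → IsClopen A → ExcludedMiddle ℓ → Clopen
  ⌊_⌋ᶜ {A} c em = ⌊ A ⌋[ em ] , IsClopen-resp-≐ (⌊⌋-≐ em A) c

  -- The polar of `_∥ y` is `Γ y`. Seriality serves the other kind of open element, the whole space,
  -- whose polar has to be empty.
  ▹-closed : (∀ y → ∃[ x ] ¬ (x ∥ y)) → {A : Pred ∣X∣ l} → Open A → Gᵒ.Closed (A ▹)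
  ▹-closed serial (inj₁ (y , A⊆y , y⊆A)) =
    inj₁ (y , (λ r x s → r x (y⊆A s)) , (λ r x s → r x (A⊆y s)))
  ▹-closed serial (inj₂ u) = inj₂ (λ y r → let (x , ¬x∥y) = serial y in ¬x∥y (r x (u x)))

  ▹-open : {A : Pred ∣X∣ l} → Closed A → Gᵒ.Open (A ▹)
  ▹-open (inj₁ (x , A⊆Γ , Γ⊆A)) = inj₁ (x , (λ r → r x (Γ⊆A ⪯-refl)) , (λ r z s → A⊆Γ s _ r))
  ▹-open (inj₂ e) = inj₂ (λ y x r → contradiction r (e x))

  ▹-clopen : (∀ y → ∃[ x ] ¬ (x ∥ y)) → {A : Pred ∣X∣ l} → IsClopen A → Gᵒ.IsClopen (A ▹)
  ▹-clopen serial (c , o) = ▹-closed serial o , ▹-open c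

  open Space
  open CompactBasis X _∋ᶜ_

  ∉ᶜ-closedSet : ∀ A → ClosedSet (Lift ℓ ∘ ∁ (_∈ᶜ A))
  ∉ᶜ-closedSet A {x} x∈A =
    A , decidable-stable (T? (proj₁ A x)) (λ x∉A → x∈A (lift x∉A)) , (λ z∈A (lift z∉A) → z∉A z∈A)

  -- The member of the cover containing the least point contains a clopen neighbourhood of it.
  -- Clopen elements are up-sets, so this single member covers everything.
  Closed-compact : {A : Pred ∣X∣ l} → Closed A → Compact A
  Closed-compact (inj₁ (x , A⊆Γ , Γ⊆A)) V oV cover =
    let (i , v) = cover (Γ⊆A ⪯-refl) ; (C , x∈C , C⊆V) = oV i v
    in i ∷ [] , λ r → here (C⊆V (Clopen-upward C (A⊆Γ r) x∈C))
  Closed-compact (inj₂ e) V oV cover = [] , λ {x} r → contradiction r (e x)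

  _⊓_ : Clopen → Clopen → ∣X∣ → Bool
  (A ⊓ C) x = proj₁ A x ∧ᵇ proj₁ C x

  ⊓-≐ : ∀ A C → (_∈ᶜ A) ∩ (_∈ᶜ C) ≐ ⟦ A ⊓ C ⟧
  ⊓-≐ A C = Equivalence.from T-∧ , Equivalence.to T-∧

  module _ (∩-clopen : ∀ A C → IsClopen ((_∈ᶜ A) ∩ (_∈ᶜ C))) where

    _∩ᶜ_ : Clopen → Clopen → Clopen
    A ∩ᶜ C = A ⊓ C , IsClopen-resp-≐ (⊓-≐ A C) (∩-clopen A C)

    isSpectral : IsClopen {0ℓ} U →
      (∀ x y → (∀ V → OpenSet V → V x ⇔ V y) → x ≈ˣ y) →
      (∀ C → ClosedSet C → Irreducible C → ∃[ x ] IsClosureOf C x) → IsSpectral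
    isSpectral X-clopen T₀ sober = record
      { T₀            = T₀
      ; compact       = Closed-compact (proj₁ X-clopen)
      ; compact-∩     = ∩-compact (λ (_ , c , _) → Closed-compact c)
                          (λ A C → A ∩ᶜ C , proj₂ (⊓-≐ A C) , proj₁ (⊓-≐ A C))
      ; compact-basis = basic-neighbourhood (λ (_ , c , _) → Closed-compact c)
                          (λ A C → A ∩ᶜ C , proj₂ (⊓-≐ A C) , proj₁ (⊓-≐ A C))
      ; sober         = sober }

-- Filters and ideals of a bounded lattice

record IsProperFilter {C : Set ℓ} (_≤_ : Rel C ℓ) (_∧_ : Op₂ C) (⊤ ⊥ : C)
                      (F : Pred C l) : Set (ℓ ⊔ l) where
  field
    ⊤-mem  : F ⊤
    up     : ∀ {a b} → a ≤ b → F a → F b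
    ∧-mem  : ∀ {a b} → F a → F b → F (a ∧ b)
    proper : ¬ F ⊥

-- An ideal is a filter for the reversed order. This interface abstracts from the records `Filter`
-- and `Ideal`, so that both sides of a canonical frame fall under one development.
record FilterSpace {C : Set ℓ} (_≤_ : Rel C ℓ) (_∧_ : Op₂ C) (⊤ ⊥ : C)
                   (X : Setoid ℓ ℓ) : Set (suc ℓ) where
  open Setoid X renaming (Carrier to ∣X∣)
  field
    mem            : ∣X∣ → C → Bool
    isProperFilter : ∀ x → IsProperFilter _≤_ _∧_ ⊤ ⊥ ⟦ mem x ⟧
    fromFilter     : ∀ {F : Pred C ℓ} → IsProperFilter _≤_ _∧_ ⊤ ⊥ F → ∣X∣
    mem-fromFilter : ∀ {F : Pred C ℓ} (f : IsProperFilter _≤_ _∧_ ⊤ ⊥ F) → F ≐ ⟦ mem (fromFilter f) ⟧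
    ≈⇔≐            : ∀ {x z} → x ≈ z ⇔ ⟦ mem x ⟧ ≐ ⟦ mem z ⟧

  infix 4 _∈ᵐ_
  _∈ᵐ_ : C → ∣X∣ → Set
  a ∈ᵐ x = ⟦ mem x ⟧ a

  open module IsProperFilter′ {x} = IsProperFilter (isProperFilter x) public

dualLattice : BoundedLattice ℓ ℓ ℓ → BoundedLattice ℓ ℓ ℓ
dualLattice B = record
  { Carrier = Carrier ; _≈_ = _≈_ ; _≤_ = flip _≤_ ; _∨_ = _∧_ ; _∧_ = _∨_ ; ⊤ = ⊥ ; ⊥ = ⊤
  ; isBoundedLattice = record
      { isLattice = record
          { isPartialOrder = Flip.isPartialOrder isPartialOrder
          ; supremum = infimum
          ; infimum  = supremum }
      ; maximum = minimum
      ; minimum = maximum } }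
  where open BoundedLattice B

module LatticeFilters (B : BoundedLattice ℓ ℓ ℓ) where
  open BoundedLattice B

  ProperFilter : Pred Carrier l → Set (ℓ ⊔ l)
  ProperFilter = IsProperFilter _≤_ _∧_ ⊤ ⊥

  Filters Ideals : Setoid ℓ ℓ → Set (suc ℓ)
  Filters = FilterSpace _≤_ _∧_ ⊤ ⊥
  Ideals  = FilterSpace (flip _≤_) _∨_ ⊥ ⊤

  principal : ∀ a → ¬ (a ≤ ⊥) → ProperFilter (a ≤_)
  principal a a≰⊥ = record
    { ⊤-mem = maximum a ; up = λ b≤c a≤b → trans a≤b b≤c ; ∧-mem = ∧-greatest ; proper = a≰⊥ }

  ⋀ : List Carrier → Carrier
  ⋀ = foldr _∧_ ⊤

  ⋀-++ˡ : ∀ as bs → ⋀ (as ++ bs) ≤ ⋀ as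
  ⋀-++ˡ []       bs = maximum _
  ⋀-++ˡ (a ∷ as) bs = ∧-greatest (x∧y≤x _ _) (trans (x∧y≤y _ _) (⋀-++ˡ as bs))

  ⋀-++ʳ : ∀ as bs → ⋀ (as ++ bs) ≤ ⋀ bs
  ⋀-++ʳ []       bs = refl
  ⋀-++ʳ (a ∷ as) bs = trans (x∧y≤y _ _) (⋀-++ʳ as bs)

  module _ (G : Pred Carrier ℓ) where

    FilterGenerated : Pred Carrier ℓ
    FilterGenerated b = ∃[ as ] All G as × ⋀ as ≤ b

    -- `F` is allowed to be improper: one application takes for `F` the down-closure of `ν[ x ]`,
    -- viewed in the dual lattice, in order to find out whether it contains `⊤`.
    FilterGenerated-⊆ : {F : Pred Carrier l} → F ⊤ → (∀ {a b} → a ≤ b → F a → F b) →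
      (∀ {a b} → F a → F b → F (a ∧ b)) → G ⊆ F → FilterGenerated ⊆ F
    FilterGenerated-⊆ {F = F} F-⊤ F-up F-∧ G⊆F (as , gs , le) = F-up le (⋀-mem gs)
      where
      ⋀-mem : ∀ {as} → All G as → F (⋀ as)
      ⋀-mem []       = F-⊤
      ⋀-mem (g ∷ gs) = F-∧ (G⊆F g) (⋀-mem gs)

    ⊆-FilterGenerated : G ⊆ FilterGenerated
    ⊆-FilterGenerated {a} g = a ∷ [] , g ∷ [] , x∧y≤x _ _

    FilterGenerated-isProperFilter : ¬ FilterGenerated ⊥ → ProperFilter FilterGenerated
    FilterGenerated-isProperFilter ¬⊥ = record
      { ⊤-mem  = [] , [] , refl
      ; up     = λ a≤b (as , gs , le) → as , gs , trans le a≤b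
      ; ∧-mem  = λ (as , gs , le) (bs , hs , le′) → as ++ bs , All.++⁺ gs hs ,
                   ∧-greatest (trans (⋀-++ˡ as bs) le) (trans (⋀-++ʳ as bs) le′)
      ; proper = ¬⊥ }

module _ (K L : BoundedLattice ℓ ℓ ℓ) where
  private
    module K = BoundedLattice K
    module L = BoundedLattice L

  image-isProperFilter : (h : K.Carrier → L.Carrier) →
    (∀ {a b} → a K.≤ b → h a L.≤ h b) →
    {F : Pred K.Carrier l} → LatticeFilters.ProperFilter K F → (∀ {a} → F a → ¬ (h a L.≤ L.⊥)) →
    LatticeFilters.ProperFilter L (λ b → ∃[ a ] F a × h a L.≤ b)
  image-isProperFilter h h-mono f h≰⊥ = record
    { ⊤-mem  = K.⊤ , ⊤-mem , L.maximum _
    ; up     = λ b≤c (a , fa , le) → a , fa , L.trans le b≤c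
    ; ∧-mem  = λ (a , fa , le) (b , fb , le′) → a K.∧ b , ∧-mem fa fb ,
                 L.∧-greatest (L.trans (h-mono (K.x∧y≤x a b)) le) (L.trans (h-mono (K.x∧y≤y a b)) le′)
    ; proper = λ (a , fa , le) → h≰⊥ fa le }
    where open IsProperFilter f

-- One side of a canonical frame

module CanonicalSide (em : ExcludedMiddle ℓ) (B : BoundedLattice ℓ ℓ ℓ) (P : Polarity ℓ)
  (fil : LatticeFilters.Filters B (Polarity.X P)) (idl : LatticeFilters.Ideals B (Polarity.Y P))
  (∥⇔≬ : ∀ {x y} → Polarity._∥_ P x y ⇔ ⟦ FilterSpace.mem fil x ⟧ ≬ ⟦ FilterSpace.mem idl y ⟧)
  (⊤≰⊥ : ¬ BoundedLattice._≤_ B (BoundedLattice.⊤ B) (BoundedLattice.⊥ B)) where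

  open BoundedLattice B
  open Polarity P using (X; Y; ∣X∣; ∣Y∣; _≈ˣ_; _∥_)
  open Galois P
  open GaloisProperties P
  open FilterSpace fil
  open LatticeFilters B
  private
    module I = FilterSpace idl

  ↑[_] : ∀ {a} → ¬ (a ≤ ⊥) → ∣X∣
  ↑[ a≰⊥ ] = fromFilter (principal _ a≰⊥)

  ∈↑⇒≥ : ∀ {a b} (a≰⊥ : ¬ (a ≤ ⊥)) → b ∈ᵐ ↑[ a≰⊥ ] → a ≤ b
  ∈↑⇒≥ a≰⊥ = proj₂ (mem-fromFilter (principal _ a≰⊥))

  ∈↑ : ∀ {a} (a≰⊥ : ¬ (a ≤ ⊥)) → a ∈ᵐ ↑[ a≰⊥ ]
  ∈↑ a≰⊥ = proj₁ (mem-fromFilter (principal _ a≰⊥)) refl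

  principalIdeal : ∀ {a} → ¬ (⊤ ≤ a) → IsProperFilter (flip _≤_) _∨_ ⊥ ⊤ (_≤ a)
  principalIdeal ⊤≰a = LatticeFilters.principal (dualLattice B) _ ⊤≰a

  ↓[_] : ∀ {a} → ¬ (⊤ ≤ a) → ∣Y∣
  ↓[ ⊤≰a ] = I.fromFilter (principalIdeal ⊤≰a)

  ∥⇒≬ : ∀ {x y} → x ∥ y → ⟦ mem x ⟧ ≬ ⟦ I.mem y ⟧
  ∥⇒≬ = Equivalence.to ∥⇔≬

  ≬⇒∥ : ∀ {x y a} → a ∈ᵐ x → a I.∈ᵐ y → x ∥ y
  ≬⇒∥ a∈x a∈y = Equivalence.from ∥⇔≬ (_ , a∈x , a∈y)

  ∥↓⇔∈ : ∀ {a} (⊤≰a : ¬ (⊤ ≤ a)) {x} → x ∥ ↓[ ⊤≰a ] ⇔ a ∈ᵐ x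
  ∥↓⇔∈ ⊤≰a = mk⇔
    (λ r → let (b , b∈x , b∈y) = ∥⇒≬ r in up (proj₂ (I.mem-fromFilter (principalIdeal ⊤≰a)) b∈y) b∈x)
    (λ a∈x → ≬⇒∥ a∈x (proj₁ (I.mem-fromFilter (principalIdeal ⊤≰a)) refl))

  -- Membership of `a` is detected by the principal ideal of `a`. If that ideal is improper, then
  -- `a` is a top element and lies in every filter.
  ⪯⇒⊆ : ∀ {x z} → x ⪯ z → ⟦ mem x ⟧ ⊆ ⟦ mem z ⟧
  ⪯⇒⊆ x⪯z {a} a∈x with em {⊤ ≤ a}
  ... | yes ⊤≤a = up ⊤≤a ⊤-mem
  ... | no  ⊤≰a = Equivalence.to (∥↓⇔∈ ⊤≰a) (x⪯z _ (Equivalence.from (∥↓⇔∈ ⊤≰a) a∈x))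

  ⊆⇒⪯ : ∀ {x z} → ⟦ mem x ⟧ ⊆ ⟦ mem z ⟧ → x ⪯ z
  ⊆⇒⪯ x⊆z y x∥y = let (a , a∈x , a∈y) = ∥⇒≬ x∥y in ≬⇒∥ (x⊆z a∈x) a∈y

  ↑⪯⇔∈ : ∀ {a} (a≰⊥ : ¬ (a ≤ ⊥)) {x} → ↑[ a≰⊥ ] ⪯ x ⇔ a ∈ᵐ x
  ↑⪯⇔∈ a≰⊥ = mk⇔ (λ r → ⪯⇒⊆ r (∈↑ a≰⊥)) (λ a∈x → ⊆⇒⪯ (λ b∈ → up (∈↑⇒≥ a≰⊥ b∈) a∈x))

  ∈-closed : ∀ a → Closed (a ∈ᵐ_)
  ∈-closed a with em {a ≤ ⊥}
  ... | yes a≤⊥ = inj₂ (λ x a∈x → proper (up a≤⊥ a∈x))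
  ... | no  a≰⊥ = inj₁ (↑[ a≰⊥ ] , Equivalence.from (↑⪯⇔∈ a≰⊥) , Equivalence.to (↑⪯⇔∈ a≰⊥))

  ∈-open : ∀ a → Open (a ∈ᵐ_)
  ∈-open a with em {⊤ ≤ a}
  ... | yes ⊤≤a = inj₂ (λ x → up ⊤≤a ⊤-mem)
  ... | no  ⊤≰a = inj₁ (↓[ ⊤≰a ] , Equivalence.from (∥↓⇔∈ ⊤≰a) , Equivalence.to (∥↓⇔∈ ⊤≰a))

  ∈-clopen : ∀ a → IsClopen (a ∈ᵐ_)
  ∈-clopen a = ∈-closed a , ∈-open a

  ⟨_⟩ : Carrier → Clopen
  ⟨ a ⟩ = (λ x → mem x a) , ∈-clopen a

  -- In the main case the least point `x` of `A` satisfies `x ∥ y`, so filter and ideal share some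
  -- `a`. Then `Γ x` lies inside `X_a` because `a` is in `x`, and `X_a` inside `_∥ y` because `a` is
  -- in `y`; as both ends equal `A`, so does `X_a`.
  clopen⇒∈ : {A : Pred ∣X∣ l} → IsClopen A → ∃[ a ] A ≐ (a ∈ᵐ_)
  clopen⇒∈ (inj₂ e , _)      = ⊥ , (λ r → contradiction r (e _)) , (λ r → contradiction r proper)
  clopen⇒∈ (inj₁ _ , inj₂ u) = ⊤ , (λ _ → ⊤-mem) , (λ {x} _ → u x)
  clopen⇒∈ (inj₁ (x , A⊆Γ , Γ⊆A) , inj₁ (y , A⊆y , y⊆A)) =
    let (a , a∈x , a∈y) = ∥⇒≬ (A⊆y (Γ⊆A ⪯-refl))
    in a , (λ r → ⪯⇒⊆ (A⊆Γ r) a∈x) , (λ a∈z → y⊆A (≬⇒∥ a∈z a∈y))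

  ⊆-injective : ∀ {a b} → (a ∈ᵐ_) ⊆ (b ∈ᵐ_) → a ≤ b
  ⊆-injective {a} a⊆b with em {a ≤ ⊥}
  ... | yes a≤⊥ = trans a≤⊥ (minimum _)
  ... | no  a≰⊥ = ∈↑⇒≥ a≰⊥ (a⊆b (∈↑ a≰⊥))

  -- The filter generated by `G` is the least point; if it is improper, no point contains `G`.
  -- Intersections of clopen elements, the sets `_S x` and preimages of `Γ u` are all of this form.
  ⊇-closed : (G : Pred Carrier ℓ) → Closed (λ x → G ⊆ ⟦ mem x ⟧)
  ⊇-closed G with em {FilterGenerated G ⊥}
  ... | yes ⊥∈ = inj₂ (λ x G⊆x → proper (FilterGenerated-⊆ G ⊤-mem up ∧-mem G⊆x ⊥∈))
  ... | no  ⊥∉ = inj₁ (fromFilter f ,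
        (λ G⊆x → ⊆⇒⪯ (λ r → FilterGenerated-⊆ G ⊤-mem up ∧-mem G⊆x (proj₂ (mem-fromFilter f) r))) ,
        (λ f⪯x g → ⪯⇒⊆ f⪯x (proj₁ (mem-fromFilter f) (⊆-FilterGenerated G g))))
    where f = FilterGenerated-isProperFilter G ⊥∉

  open Space

  open⇒∈ : ∀ {V} → OpenSet V → ∀ {x} → V x → ∃[ a ] a ∈ᵐ x × (a ∈ᵐ_) ⊆ V
  open⇒∈ oV v = let (A , r , A⊆V) = oV v ; (a , A⊆a , a⊆A) = clopen⇒∈ (proj₂ A)
                in a , A⊆a r , (λ s → A⊆V (a⊆A s))

  ∈-openSet : ∀ a → OpenSet (Lift ℓ ∘ (a ∈ᵐ_))
  ∈-openSet a (lift r) = ⟨ a ⟩ , r , lift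

  -- The union of an irreducible closed set of filters is its generic point.
  sober : ∀ C → ClosedSet C → Irreducible C → ∃[ x ] IsClosureOf C x
  sober C closed ((x₀ , x₀∈C) , irreducible) = g , closed , g∈C , λ D closedD g∈D {z} z∈C →
    em⇒dne em (λ z∉D → let (a , a∈z , a⊆) = open⇒∈ closedD z∉D
                       in a⊆ (proj₁ (mem-fromFilter isFilter) (z , z∈C , a∈z)) g∈D)
    where
    F : Pred Carrier ℓ
    F a = ∃[ z ] C z × a ∈ᵐ z

    F-∧ : ∀ {a b} → F a → F b → F (a ∧ b)
    F-∧ {a} {b} (z , z∈C , a∈z) (w , w∈C , b∈w) = em⇒dne em λ ¬Fa∧b →
      -- If no filter in `C` contained `a ∧ b`, none would contain both `a` and `b`. Two closed sets
      -- would then cover `C`, missing `w` and `z` respectively in contradiction to irreducibility.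
      let cover : C ⊆ (Lift ℓ ∘ ∁ (a ∈ᵐ_)) ∪ (Lift ℓ ∘ ∁ (b ∈ᵐ_))
          cover {x} x∈C = Sum.[ (λ a∈x → inj₂ (lift (λ b∈x → ¬Fa∧b (x , x∈C , ∧-mem a∈x b∈x))))
                              , (λ a∉x → inj₁ (lift a∉x)) ]′ (toSum (T? (mem x a)))
      in Sum.[ (λ C⊆ → lower (C⊆ z∈C) a∈z) , (λ C⊆ → lower (C⊆ w∈C) b∈w) ]′
           (irreducible _ _ (∉ᶜ-closedSet ⟨ a ⟩) (∉ᶜ-closedSet ⟨ b ⟩) cover)

    isFilter : ProperFilter F
    isFilter = record
      { ⊤-mem  = x₀ , x₀∈C , ⊤-mem
      ; up     = λ a≤b (z , z∈C , a∈z) → z , z∈C , up a≤b a∈z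
      ; ∧-mem  = F-∧
      ; proper = λ (_ , _ , ⊥∈z) → proper ⊥∈z }

    g : ∣X∣
    g = fromFilter isFilter

    g∈C : C g
    g∈C = em⇒dne em λ g∉C →
      let (a , a∈g , a⊆) = open⇒∈ closed g∉C
          (z , z∈C , a∈z) = proj₂ (mem-fromFilter isFilter) a∈g
      in a⊆ a∈z z∈C

  isSRFSide : IsSRFSide P
  isSRFSide = record
    { nonempty     = ↑[ ⊤≰⊥ ]
    ; quasi-serial = λ x → ↓[ ⊤≰⊥ ] , λ x∥y → proper (Equivalence.to (∥↓⇔∈ ⊤≰⊥) x∥y)
    ; separated    = record
        { isPreorder = record
            { isEquivalence = Setoid.isEquivalence X
            ; reflexive = ≈⇒⪯
            ; trans     = ⪯-trans }
        ; antisym = λ x⪯z z⪯x → Equivalence.from ≈⇔≐ (⪯⇒⊆ x⪯z , ⪯⇒⊆ z⪯x) }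
    ; X-clopen     = X-clopen
    ; ∩-clopen     = ∩-clopen
    ; closed⇒⋂     = closed⇒⋂
    ; ⋂⇒closed     = λ {I} A → let a = λ i → proj₁ (clopen⇒∈ (proj₂ (A i)))
                                   A≐ = λ i → proj₂ (clopen⇒∈ (proj₂ (A i)))
        in Closed-resp-≐ ( (λ r i → proj₂ (A≐ i) (r (i , ≡.refl)))
                         , (λ { r (i , ≡.refl) → proj₁ (A≐ i) (r i) }))
             (⊇-closed (λ b → ∃[ i ] b ≡ a i))
    ; spectral     = isSpectral ∩-clopen X-clopen T₀ sober }
    where
    X-clopen : IsClopen {0ℓ} U
    X-clopen = IsClopen-resp-≐ ((λ _ → tt) , (λ _ → ⊤-mem)) (∈-clopen ⊤)

    ∩-clopen : ∀ A C → IsClopen ((_∈ᶜ A) ∩ (_∈ᶜ C))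
    ∩-clopen A C =
      let (a , A⊆a , a⊆A) = clopen⇒∈ (proj₂ A) ; (c , C⊆c , c⊆C) = clopen⇒∈ (proj₂ C)
      in IsClopen-resp-≐ ( (λ r → a⊆A (up (x∧y≤x _ _) r) , c⊆C (up (x∧y≤y _ _) r))
                         , (λ (r , s) → ∧-mem (A⊆a r) (C⊆c s)))
           (∈-clopen (a ∧ c))

    closed⇒⋂ : (C : Pred ∣X∣ ℓ) → Closed C →
               Σ[ I ∈ Set ℓ ] Σ[ A ∈ (I → Clopen) ] C ≐ ⋂ I (λ i → _∈ᶜ A i)
    closed⇒⋂ C (inj₁ (x , C⊆Γ , Γ⊆C)) =
      (Σ[ a ∈ Carrier ] a ∈ᵐ x) , (λ (a , _) → ⟨ a ⟩) ,
      (λ r (a , a∈x) → ⪯⇒⊆ (C⊆Γ r) a∈x) , (λ r → Γ⊆C (⊆⇒⪯ (λ {a} a∈x → r (a , a∈x))))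
    closed⇒⋂ C (inj₂ e) =
      Unit.⊤ , (λ _ → ⟨ ⊥ ⟩) , (λ r → contradiction r (e _)) , (λ r → contradiction (r _) proper)

    T₀ : ∀ x z → (∀ V → OpenSet V → V x ⇔ V z) → x ≈ˣ z
    T₀ x z e = Equivalence.from ≈⇔≐
      ( (λ {a} a∈x → lower (Equivalence.to (e _ (∈-openSet a)) (lift a∈x)))
      , (λ {a} a∈z → lower (Equivalence.from (e _ (∈-openSet a)) (lift a∈z))))

-- The canonical frame of a lattice satisfies the frame axioms

module _ (em : ExcludedMiddle ℓ) (L : QLattice ℓ) where
  open QLattice L

  filterSpace : LatticeFilters.Filters boundedLattice (filters L)
  filterSpace = record
    { mem            = Filter.mem
    ; isProperFilter = λ x → record
        { ⊤-mem = Filter.⊤-mem x ; up = Filter.up x ; ∧-mem = Filter.∧-mem x ; proper = Filter.proper x }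
    ; fromFilter     = λ {F} f → let open IsProperFilter f ; (to , from) = ⌊⌋-≐ em F in record
        { mem    = ⌊ F ⌋[ em ]
        ; ⊤-mem  = to ⊤-mem
        ; up     = λ a≤b r → to (up a≤b (from r))
        ; ∧-mem  = λ r s → to (∧-mem (from r) (from s))
        ; proper = λ r → proper (from r) }
    ; mem-fromFilter = λ {F} _ → ⌊⌋-≐ em F
    ; ≈⇔≐            = mk⇔ (λ r → r) (λ r → r) }

  idealSpace : LatticeFilters.Ideals boundedLattice (ideals L)
  idealSpace = record
    { mem            = Ideal.mem
    ; isProperFilter = λ y → record
        { ⊤-mem = Ideal.⊥-mem y ; up = Ideal.down y ; ∧-mem = Ideal.∨-mem y ; proper = Ideal.proper y }
    ; fromFilter     = λ {F} f → let open IsProperFilter f ; (to , from) = ⌊⌋-≐ em F in record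
        { mem    = ⌊ F ⌋[ em ]
        ; ⊥-mem  = to ⊤-mem
        ; down   = λ a≤b r → to (up a≤b (from r))
        ; ∨-mem  = λ r s → to (∧-mem (from r) (from s))
        ; proper = λ r → proper (from r) }
    ; mem-fromFilter = λ {F} _ → ⌊⌋-≐ em F
    ; ≈⇔≐            = mk⇔ (λ r → r) (λ r → r) }

module CanonicalFrame (em : ExcludedMiddle ℓ) (L : QLattice ℓ) where
  open QLattice L
  open Frame (canonicalFrame L)

  ⊤≰⊥ : ¬ (⊤ ≤ ⊥)
  ⊤≰⊥ ⊤≤⊥ = ⊥≉⊤ (antisym (minimum ⊤) ⊤≤⊥)

  module Fil = CanonicalSide em boundedLattice polarity (filterSpace em L) (idealSpace em L)
                 (mk⇔ (λ r → r) (λ r → r)) ⊤≰⊥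
  -- Flipping the polarity exchanges the two components of a meeting witness, which is why `∥⇔≬` is
  -- an equivalence and not an identity.
  module Idl = CanonicalSide em (dualLattice boundedLattice) (dual polarity)
                 (idealSpace em L) (filterSpace em L)
                 (mk⇔ (λ (a , r , s) → a , s , r) (λ (a , r , s) → a , s , r)) ⊤≰⊥

  S⇔ : ∀ {y x} → y S x ⇔ (∀ {a} → _∈ᶠ_ L a x → _∈ⁱ_ L (ν a) y)
  S⇔ {y} {x} = mk⇔ to from
    where
    to : y S x → ∀ {a} → _∈ᶠ_ L a x → _∈ⁱ_ L (ν a) y
    to r a∈x = r (_ ∷ [] , (_ , a∈x , Eq.refl) ∷ [] , x≤x∨y _ _)

    from : (∀ {a} → _∈ᶠ_ L a x → _∈ⁱ_ L (ν a) y) → y S x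
    -- `Generated` is definitionally the generated filter of the dual lattice.
    from r = LatticeFilters.FilterGenerated-⊆ (dualLattice boundedLattice) (ν[_] L x)
      {F = ⟦ Ideal.mem y ⟧} (Ideal.⊥-mem y) (Ideal.down y) (Ideal.∨-mem y)
      (λ (a , a∈x , b≈νa) → Ideal.down y (reflexive b≈νa) (r a∈x))

  -- The test pair is the principal filter of `a` and the principal ideal of `ν a`: antitonicity
  -- makes them `S`-related, so `x` meets that ideal. If either is improper, `ν a` is a top element.
  ∈-ν : ∀ {x a} → (∀ z → _∈ᶠ_ L a z → x S′ z) → _∈ᶠ_ L (ν a) x
  ∈-ν {x} {a} r with em {a ≤ ⊥}
  ... | yes a≤⊥ = Filter.up x (trans (reflexive (Eq.sym ν-⊥)) (ν-antitone a≤⊥)) (Filter.⊤-mem x)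
  ... | no  a≰⊥ with em {⊤ ≤ ν a}
  ...   | yes ⊤≤νa = Filter.up x ⊤≤νa (Filter.⊤-mem x)
  ...   | no  ⊤≰νa = Equivalence.to (Fil.∥↓⇔∈ ⊤≰νa {x})
          (r Fil.↑[ a≰⊥ ] (Fil.∈↑ a≰⊥) Fil.↓[ ⊤≰νa ]
            (Equivalence.from (S⇔ {y = Fil.↓[ ⊤≰νa ]} {x = Fil.↑[ a≰⊥ ]})
              (λ b∈ → Ideal.down Fil.↓[ ⊤≰νa ] (ν-antitone (Fil.∈↑⇒≥ a≰⊥ b∈)) (Idl.∈↑ ⊤≰νa))))

  -- If `Γ x` is clopen it equals some `X_a`, so `a` is the least member of `x`. Then `ν a` is the
  -- largest value of `ν` on `x`, and `y S x` just says that `y` contains `ν a`.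
  S-clopen : ∀ x → GX.IsClopen (GX.Γ x) → GY.IsClopen (_S x)
  S-clopen x c = GaloisProperties.IsClopen-resp-≐ (dual polarity) {C = _S x}
    ( (λ {y} νa∈y → Equivalence.from (S⇔ {y} {x})
         (λ b∈x → Ideal.down y (ν-antitone (Fil.⊆-injective
           (λ {z} a∈z → Fil.⪯⇒⊆ {x} {z} (a⊆Γ {z} a∈z) b∈x))) νa∈y))
    , (λ {y} (r : y S x) → Equivalence.to (S⇔ {y} {x}) r (Γ⊆a {x} (λ _ s → s))) )
    (Idl.∈-clopen (ν a))
    where
    a = proj₁ (Fil.clopen⇒∈ c)
    Γ⊆a = proj₁ (proj₂ (Fil.clopen⇒∈ c))
    a⊆Γ = proj₂ (proj₂ (Fil.clopen⇒∈ c))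

  S-closed : ∀ x → GY.Closed (_S x)
  S-closed x = GaloisProperties.Closed-resp-≐ (dual polarity) {C = _S x}
    ( (λ {y} (r : ν[_] L x ⊆ ⟦ Ideal.mem y ⟧) →
         Equivalence.from (S⇔ {y} {x}) (λ {a} a∈x → r (a , a∈x , Eq.refl)))
    , (λ {y} (r : y S x) {b} (a , a∈x , b≈νa) →
         Ideal.down y (reflexive b≈νa) (Equivalence.to (S⇔ {y} {x}) r a∈x)) )
    (Idl.⊇-closed (ν[_] L x))

  -- The ideal generated by `ν[ x ]` is merely its down-closure, since `ν a ∨ ν b ≤ ν (a ∧ b)` and
  -- `x` is closed under meets. When proper, this ideal is the `y` at which `z S′ x` is tested.
  S′⇔ : ∀ {z x} → z S′ x ⇔ (∃[ a ] _∈ᶠ_ L a x × _∈ᶠ_ L (ν a) z)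
  S′⇔ {z} {x} = mk⇔ to λ (a , a∈x , νa∈z) y r → ν a , νa∈z , Equivalence.to (S⇔ {y} {x}) r a∈x
    where
    module D = LatticeFilters (dualLattice boundedLattice)

    νF : ∀ {b} → D.FilterGenerated (ν[_] L x) b → ∃[ a ] _∈ᶠ_ L a x × b ≤ ν a
    νF = D.FilterGenerated-⊆ (ν[_] L x) {F = λ b → ∃[ a ] _∈ᶠ_ L a x × b ≤ ν a}
      (⊤ , Filter.⊤-mem x , minimum _)
      (λ b≤c (a , a∈x , le) → a , a∈x , trans b≤c le)
      (λ (a , a∈x , le) (b , b∈x , le′) → a ∧ b , Filter.∧-mem x a∈x b∈x ,
         ∨-least (trans le (ν-antitone (x∧y≤x _ _))) (trans le′ (ν-antitone (x∧y≤y _ _))))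
      (λ (a , a∈x , b≈νa) → a , a∈x , reflexive b≈νa)

    to : z S′ x → ∃[ a ] _∈ᶠ_ L a x × _∈ᶠ_ L (ν a) z
    to r with em {D.FilterGenerated (ν[_] L x) ⊤}
    ... | yes ⊤∈ = let (a , a∈x , ⊤≤νa) = νF ⊤∈ in a , a∈x , Filter.up z ⊤≤νa (Filter.⊤-mem z)
    ... | no  ⊤∉ =
      let f = D.FilterGenerated-isProperFilter (ν[_] L x) ⊤∉
          y = FilterSpace.fromFilter (idealSpace em L) f
          (b , b∈z , b∈y) = r y (λ s → proj₁ (FilterSpace.mem-fromFilter (idealSpace em L) f) s)
          (a , a∈x , b≤νa) = νF (proj₂ (FilterSpace.mem-fromFilter (idealSpace em L) f) b∈y)
      in a , a∈x , Filter.up z b≤νa b∈z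

  -- z S′ x holds iff x meets the ideal ν⁻¹[z].
  S′-stableʳ : ∀ z → GX.Stable (z S′_)
  S′-stableʳ z = Open-stable (Open-resp-≐
    ((λ {x} → Equivalence.from (S′⇔ {z} {x})) , (λ {x} → Equivalence.to (S′⇔ {z} {x}))) meets-open)
    where
    open GaloisProperties polarity

    meets-open : GX.Open (λ x → ∃[ a ] _∈ᶠ_ L a x × _∈ᶠ_ L (ν a) z)
    -- The ideal `ν⁻¹[z]` is improper exactly when `z` contains `ν ⊤`. That it is closed under joins
    -- is where the law `ν-∨` enters.
    meets-open with T? (Filter.mem z (ν ⊤))
    ... | yes ν⊤∈z = inj₂ (λ x → ⊤ , Filter.⊤-mem x , ν⊤∈z)
    ... | no  ν⊤∉z = inj₁ (record
            { mem    = λ a → Filter.mem z (ν a)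
            ; ⊥-mem  = Filter.up z (reflexive (Eq.sym ν-⊥)) (Filter.⊤-mem z)
            ; down   = λ a≤b → Filter.up z (ν-antitone a≤b)
            ; ∨-mem  = λ r s → Filter.up z (reflexive (Eq.sym (ν-∨ _ _))) (Filter.∧-mem z r s)
            ; proper = ν⊤∉z } , (λ r → r) , (λ r → r))

  isSRF : IsSRF (canonicalFrame L)
  isSRF = record
    { sideX      = Fil.isSRFSide
    ; sideY      = Idl.isSRFSide
    ; S-closed   = S-closed
    ; S-clopen   = S-clopen
    ; S-down     = λ y {x} {z} z⪯x r → Equivalence.from (S⇔ {y} {z})
                     (λ a∈z → Equivalence.to (S⇔ {y} {x}) r (Fil.⪯⇒⊆ {z} {x} z⪯x a∈z))
    ; S′-stableˡ = λ x → GaloisProperties.◃-stable polarity (_S x)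
    ; S′-stableʳ = S′-stableʳ
    ; ∥-open     = λ y (a , a∈x , a∈y) → Fil.⟨ a ⟩ , a∈x , (λ a∈z → a , a∈z , a∈y)
    ; S-closedˢ  = S-closedˢ }
    where
    S-closedˢ : ∀ y → GX.Space.ClosedSet (y S_)
    S-closedˢ y {x} ¬ySx with em {∃[ a ] _∈ᶠ_ L a x × ¬ _∈ⁱ_ L (ν a) y}
    ... | yes (a , a∈x , νa∉y) = Fil.⟨ a ⟩ , a∈x , λ {z} a∈z r → νa∉y (Equivalence.to (S⇔ {y} {z}) r a∈z)
    ... | no  ¬∃ = ⊥-elim (¬ySx (Equivalence.from (S⇔ {y} {x}) (λ {a} a∈x →
            decidable-stable (T? (Ideal.mem y (ν a))) (λ νa∉y → ¬∃ (a , a∈x , νa∉y)))))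

-- Homomorphisms induce morphisms of canonical frames

module CanonicalMap (em : ExcludedMiddle ℓ) {K L : QLattice ℓ} (h : QHom K L) where
  private
    module K = QLattice K
    module L = QLattice L
    module CK = CanonicalFrame em K
    module CL = CanonicalFrame em L
    module FK = Frame (canonicalFrame K)
    module FL = Frame (canonicalFrame L)
  open QHom h
  open FrameMap (canonicalMap h)

  module _ (x : Filter K) (h≰⊥ : ∀ {a} → _∈ᶠ_ K a x → ¬ (to a L.≤ L.⊥)) where
    private
      f = image-isProperFilter K.boundedLattice L.boundedLattice to mono
            (FilterSpace.isProperFilter (filterSpace em K) x) h≰⊥

    imageFilter : Filter L
    imageFilter = FilterSpace.fromFilter (filterSpace em L) f

    ∈-imageFilter : ∀ {b} → _∈ᶠ_ L b imageFilter → ∃[ a ] _∈ᶠ_ K a x × to a L.≤ b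
    ∈-imageFilter = proj₂ (FilterSpace.mem-fromFilter (filterSpace em L) f)

    ⪯-imageFilter : x FK.GX.⪯ p₀ imageFilter
    ⪯-imageFilter = CK.Fil.⊆⇒⪯ {x} {p₀ imageFilter}
      (λ {a} a∈x → proj₁ (FilterSpace.mem-fromFilter (filterSpace em L) f) (a , a∈x , L.refl))

  module _ (y : Ideal K) (h≱⊤ : ∀ {a} → _∈ⁱ_ K a y → ¬ (L.⊤ L.≤ to a)) where
    private
      f = image-isProperFilter (dualLattice K.boundedLattice) (dualLattice L.boundedLattice) to mono
            (FilterSpace.isProperFilter (idealSpace em K) y) h≱⊤

    imageIdeal : Ideal L
    imageIdeal = FilterSpace.fromFilter (idealSpace em L) f

    ∈-imageIdeal : ∀ {b} → _∈ⁱ_ L b imageIdeal → ∃[ a ] _∈ⁱ_ K a y × b L.≤ to a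
    ∈-imageIdeal = proj₂ (FilterSpace.mem-fromFilter (idealSpace em L) f)

    ⪯-imageIdeal : y FK.GY.⪯ q₀ imageIdeal
    ⪯-imageIdeal = CK.Idl.⊆⇒⪯ {y} {q₀ imageIdeal}
      (λ {a} a∈y → proj₁ (FilterSpace.mem-fromFilter (idealSpace em L) f) (a , a∈y , L.refl))

  -- The back conditions are witnessed by the filter or ideal generated by an image. Were it
  -- improper, the point it comes from would meet the preimage it is assumed not to meet.
  isSRFMorphism : IsSRFMorphism (canonicalMap h)
  isSRFMorphism = record
    { I-forth  = λ x∦y (a , r , s) → x∦y (to a , r , s)
    ; I-backˣ  = λ {x} {y} x∦qy →
        let h≰⊥ = λ {a} a∈x ha≤⊥ → x∦qy (a , a∈x , Ideal.down y ha≤⊥ (Ideal.⊥-mem y))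
        in imageFilter x h≰⊥ , ⪯-imageFilter x h≰⊥ ,
           λ (b , b∈ , b∈y) → let (a , a∈x , ha≤b) = ∈-imageFilter x h≰⊥ b∈
                              in x∦qy (a , a∈x , Ideal.down y ha≤b b∈y)
    ; I-backʸ  = λ {x} {y} px∦y →
        let h≱⊤ = λ {a} a∈y ⊤≤ha → px∦y (a , Filter.up x ⊤≤ha (Filter.⊤-mem x) , a∈y)
        in imageIdeal y h≱⊤ , ⪯-imageIdeal y h≱⊤ ,
           λ (b , b∈x , b∈) → let (a , a∈y , b≤ha) = ∈-imageIdeal y h≱⊤ b∈
                              in px∦y (a , Filter.up x b≤ha b∈x , a∈y)
    ; S-iff    = λ {v} {z} → mk⇔ (S-forth {v} {z}) (S-back {v} {z})
    ; p-closed = λ u → GaloisProperties.Closed-resp-≐ FL.polarity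
        ( (λ {x} r → CK.Fil.⊆⇒⪯ {u} {p₀ x} (λ {a} a∈u → r (a , a∈u , ≡.refl)))
        , (λ {x} u⪯px → λ { (a , a∈u , ≡.refl) → CK.Fil.⪯⇒⊆ {u} {p₀ x} u⪯px a∈u }) )
        (CL.Fil.⊇-closed (λ b → ∃[ a ] _∈ᶠ_ K a u × b ≡ to a))
    ; q-closed = λ u → GaloisProperties.Closed-resp-≐ (dual FL.polarity)
        ( (λ {y} r → CK.Idl.⊆⇒⪯ {u} {q₀ y} (λ {a} a∈u → r (a , a∈u , ≡.refl)))
        , (λ {y} u⪯qy → λ { (a , a∈u , ≡.refl) → CK.Idl.⪯⇒⊆ {u} {q₀ y} u⪯qy a∈u }) )
        (CL.Idl.⊇-closed (λ b → ∃[ a ] _∈ⁱ_ K a u × b ≡ to a)) }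
    where
    S-forth : ∀ {v z} → q₀ v FK.S z → ∃[ x ] z FK.GX.⪯ p₀ x × v FL.S x
    S-forth {v} {z} r = imageFilter z h≰⊥ , ⪯-imageFilter z h≰⊥ ,
      Equivalence.from (CL.S⇔ {v} {imageFilter z h≰⊥}) λ b∈ →
        let (a , a∈z , ha≤b) = ∈-imageFilter z h≰⊥ b∈
        in Ideal.down v (L.ν-antitone ha≤b) (νa∈v a∈z)
      where
      νa∈v : ∀ {a} → _∈ᶠ_ K a z → _∈ⁱ_ L (L.ν (to a)) v
      νa∈v {a} a∈z = Ideal.down v (L.reflexive (L.Eq.sym (ν-homo a)))
                       (Equivalence.to (CK.S⇔ {q₀ v} {z}) r a∈z)

      -- Properness rests on `ν-⊥`: an image element below `⊥` would put `⊤` into the proper ideal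
      -- `v`.
      h≰⊥ : ∀ {a} → _∈ᶠ_ K a z → ¬ (to a L.≤ L.⊥)
      h≰⊥ a∈z ha≤⊥ = Ideal.proper v (Ideal.down v
        (L.trans (L.reflexive (L.Eq.sym L.ν-⊥)) (L.ν-antitone ha≤⊥)) (νa∈v a∈z))

    S-back : ∀ {v z} → (∃[ x ] z FK.GX.⪯ p₀ x × v FL.S x) → q₀ v FK.S z
    S-back {v} {z} (x , z⪯px , r) = Equivalence.from (CK.S⇔ {q₀ v} {z}) λ {a} a∈z →
      Ideal.down v (L.reflexive (ν-homo a))
        (Equivalence.to (CL.S⇔ {v} {x}) r (CK.Fil.⪯⇒⊆ {z} {p₀ x} z⪯px a∈z))

-- Points and clopen elements on one side of an SRF frame

module ClopenDuality (em : ExcludedMiddle ℓ) (P : Polarity ℓ)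
  (sX : IsSRFSide P) (sY : IsSRFSide (dual P)) where

  open Polarity P
  open Galois P
  open GaloisProperties P
  private
    module GY = Galois (dual P)
    module GYP = GaloisProperties (dual P)
    module SX = IsSRFSide sX
    module SY = IsSRFSide sY

  infixr 7 _∧ᶜ_
  _∧ᶜ_ : Clopen → Clopen → Clopen
  _∧ᶜ_ = _∩ᶜ_ SX.∩-clopen

  ⊤ᶜ ⊥ᶜ : Clopen
  ⊤ᶜ = (λ _ → true) , SX.X-clopen
  -- The empty set is the polar of the whole of `Y`, by quasi-seriality, and inherits clopenness
  -- from it.
  ⊥ᶜ = (λ _ → false) , IsClopen-resp-≐
    ((λ {x} r → let (y , x∦y) = SX.quasi-serial x in contradiction (r y tt) x∦y) , (λ ()))
    (GYP.▹-clopen SX.quasi-serial SY.X-clopen)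

  _ᵒ : Clopen → GY.Clopen
  A ᵒ = GYP.⌊ ▹-clopen SY.quasi-serial (proj₂ A) ⌋ᶜ em

  ᵒ-≐ : ∀ A → (_∈ᶜ A) ▹ ≐ (GY._∈ᶜ A ᵒ)
  ᵒ-≐ A = ⌊⌋-≐ em ((_∈ᶜ A) ▹)

  -- The polar of a union is the intersection of the polars, so joins on this side reduce to
  -- intersections of clopen elements on the other.
  ∪▹◃-clopen : ∀ A C → IsClopen ((((_∈ᶜ A) ∪ (_∈ᶜ C)) ▹) ◃)
  ∪▹◃-clopen A C = GYP.▹-clopen SX.quasi-serial (GYP.IsClopen-resp-≐
    ( (λ {y} r x → Sum.[ proj₂ (ᵒ-≐ A) (proj₁ r) x , proj₂ (ᵒ-≐ C) (proj₂ r) x ]′)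
    , (λ {y} r → proj₁ (ᵒ-≐ A) (λ x a → r x (inj₁ a)) , proj₁ (ᵒ-≐ C) (λ x c → r x (inj₂ c))) )
    (SY.∩-clopen (A ᵒ) (C ᵒ)))

  -- `Γ x` is an intersection of clopen elements, all of which contain `x` and hence `z`.
  ⊆ᶜ⇒⪯ : ∀ {x z} → (∀ A → x ∈ᶜ A → z ∈ᶜ A) → x ⪯ z
  ⊆ᶜ⇒⪯ {x} r with SX.closed⇒⋂ (Γ x) (inj₁ (x , (λ s → s) , (λ s → s)))
  ... | I , A , to , from = from (λ i → r (A i) (to ⪯-refl i))

  ∈ᶜ-injective : ∀ {x z} → (∀ A → x ∈ᶜ A ⇔ z ∈ᶜ A) → x ≈ˣ z
  ∈ᶜ-injective e = antisym (⊆ᶜ⇒⪯ (λ A → Equivalence.to (e A))) (⊆ᶜ⇒⪯ (λ A → Equivalence.from (e A)))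
    where open IsPartialOrder SX.separated using (antisym)

  ClopenFilter : Pred (Pred Clopen 0ℓ) ℓ
  ClopenFilter = IsProperFilter _⊆ᶜ_ _∧ᶜ_ ⊤ᶜ ⊥ᶜ

  -- The points all of whose clopen neighbourhoods lie in F form an irreducible
  -- closed set, being the closure of the directed set of least elements of
  -- members of F; its generic point is the one sought.
  module _ {F : Pred Clopen 0ℓ} (f : ClopenFilter F) where
    open IsProperFilter f
    open Space
    private
      least : ∀ A → F A → ∃[ x ] (_∈ᶜ A) ≐ Γ x
      least (_ , inj₁ r , _) FA = r
      least (_ , inj₂ e , _) FA = contradiction (up (λ {x} r → contradiction r (e x)) FA) proper

      C : Pred ∣X∣ ℓ
      C z = ∀ B → z ∈ᶜ B → F B

      least∈C : ∀ A (FA : F A) → C (proj₁ (least A FA))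
      least∈C A FA B x∈B = up (λ r → Clopen-upward B (proj₁ (proj₂ (least A FA)) r) x∈B) FA

      closed : ClosedSet C
      closed {z} z∉C with em {∃[ B ] z ∈ᶜ B × ¬ F B}
      ... | yes (B , z∈B , ¬FB) = B , z∈B , λ w∈B Cw → ¬FB (Cw B w∈B)
      ... | no  ¬∃ = contradiction (λ B z∈B → em⇒stable (λ ¬FB → ¬∃ (B , z∈B , ¬FB))) z∉C
        where
        em⇒stable : {Q : Set} → ¬ ¬ Q → Q
        em⇒stable ¬¬q = lower (em⇒dne em (λ ¬q → ¬¬q (λ q → ¬q (lift q))))

      irreducible : Irreducible C
      irreducible = (_ , least∈C ⊤ᶜ ⊤-mem) , split
        where
        split : ∀ D E → ClosedSet D → ClosedSet E → C ⊆ D ∪ E → C ⊆ D ⊎ C ⊆ E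
        split D E closedD closedE C⊆D∪E with em {C ⊆ D} | em {C ⊆ E}
        ... | yes C⊆D | _       = inj₁ C⊆D
        ... | no  _   | yes C⊆E = inj₂ C⊆E
        ... | no  C⊈D | no  C⊈E =
          -- Both neighbourhoods belong to `F` by the definition of `C`, hence so does their
          -- intersection. Its least point lies in `C` but in neither `D` nor `E`.
          let (z , Cz , z∉D) = ∁-⊈ em C⊈D ; (B , z∈B , B⊆∁D) = closedD z∉D
              (w , Cw , w∉E) = ∁-⊈ em C⊈E ; (B′ , w∈B′ , B′⊆∁E) = closedE w∉E
              F∩ = ∧-mem (Cz B z∈B) (Cw B′ w∈B′)
              x∈∩ = proj₂ (⊓-≐ B B′) (proj₂ (proj₂ (least (B ∧ᶜ B′) F∩)) ⪯-refl)
          in contradiction (C⊆D∪E (least∈C (B ∧ᶜ B′) F∩))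
               Sum.[ B⊆∁D (proj₁ x∈∩) , B′⊆∁E (proj₂ x∈∩) ]′

      generic = IsSpectral.sober SX.spectral C closed irreducible

    point : ∣X∣
    point = proj₁ generic

    -- If the generic point missed a member `A` of `F`, the closed complement of `A` would contain
    -- all of `C`, and with it the least point of `A`.
    point∈ : ∀ A → point ∈ᶜ A ⇔ F A
    point∈ A = mk⇔ (proj₁ (proj₂ (proj₂ generic)) A) λ FA →
      decidable-stable (T? (proj₁ A point)) λ p∉A →
        lower (proj₂ (proj₂ (proj₂ generic)) _ (∉ᶜ-closedSet A) (lift p∉A) (least∈C A FA))
          (proj₂ (proj₂ (least A FA)) ⪯-refl)

-- The clopen elements form a lattice with quasi-complement

module ClopenAlgebra (em : ExcludedMiddle ℓ) (𝔉 : Frame ℓ) (ax : IsSRF 𝔉) where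
  open Frame 𝔉
  open IsSRF ax
  open GX
  open GaloisProperties polarity
  open ClopenOps em 𝔉
  module CX = ClopenDuality em polarity sideX sideY
  module CY = ClopenDuality em (dual polarity) sideY sideX

  join-≐ : ∀ A C → (((_∈ᶜ A) ∪ (_∈ᶜ C)) ▹) ◃ ≐ ⟦ join A C ⟧
  join-≐ A C = ⌊⌋-≐ em ((((_∈ᶜ A) ∪ (_∈ᶜ C)) ▹) ◃)

  star-≐ : ∀ A → (λ x → ∀ z → z ∈ᶜ A → x S′ z) ≐ ⟦ star A ⟧
  star-≐ A = ⌊⌋-≐ em (λ x → ∀ z → z ∈ᶜ A → x S′ z)

  S′-upward : ∀ {u x z} → x ⪯ z → u S′ x → u S′ z
  S′-upward x⪯z r y ySz = r y (S-down y x⪯z ySz)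

  -- `u S′_` is an up-set, so the condition over all points of `A` reduces to the least one. This
  -- exhibits `A *` as a polar, to which `S-clopen` applies.
  star-Γ : ∀ A {x} → (_∈ᶜ A) ≐ Γ x → (_S x) ◃ ≐ ⟦ star A ⟧
  star-Γ A (A⊆Γ , Γ⊆A) =
    (λ r → proj₁ (star-≐ A) (λ z z∈A → S′-upward (A⊆Γ z∈A) r)) ,
    (λ r → proj₂ (star-≐ A) r _ (Γ⊆A ⪯-refl))

  star-clopen : ∀ A → IsClopen ⟦ star A ⟧
  star-clopen A@(_ , inj₁ (x , A≐Γ) , _) = IsClopen-resp-≐ (star-Γ A A≐Γ)
    (GaloisProperties.▹-clopen (dual polarity) (IsSRFSide.quasi-serial sideX)
      (S-clopen x (IsClopen-resp-≐ A≐Γ (proj₂ A))))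
  star-clopen A@(_ , inj₂ e , _) = IsClopen-resp-≐
    ((λ _ → proj₁ (star-≐ A) (λ z z∈A → contradiction z∈A (e z))) , (λ _ → tt))
    (IsSRFSide.X-clopen sideX)

  clopenClosed : ClopenClosed em 𝔉
  clopenClosed = record
    { meet-clopen = λ A C → proj₂ (A CX.∧ᶜ C)
    ; join-clopen = λ A C → IsClopen-resp-≐ (join-≐ A C) (CX.∪▹◃-clopen A C)
    ; top-clopen  = proj₂ CX.⊤ᶜ
    ; bot-clopen  = proj₂ CX.⊥ᶜ
    ; star-clopen = star-clopen }

  open ClopenClosed clopenClosed hiding (star-clopen)

  -- `E` ranges over all stable sets because the law for the quasi-complement of a join takes the
  -- set `x S′_` for it.
  ∨-least : ∀ A C {E : Pred ∣X∣ l} → Stable E → (_∈ᶜ A) ⊆ E → (_∈ᶜ C) ⊆ E → (_∈ᶜ A ∨ᶜ C) ⊆ E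
  ∨-least A C (_ , stable) A⊆E C⊆E r = stable (λ y E▹y →
    proj₂ (join-≐ A C) r y (λ x → Sum.[ (λ a → E▹y x (A⊆E a)) , (λ c → E▹y x (C⊆E c)) ]′))

  ∨-upperˡ : ∀ A C → A ⊆ᶜ A ∨ᶜ C
  ∨-upperˡ A C r = proj₁ (join-≐ A C) (▹◃-extensive ((_∈ᶜ A) ∪ (_∈ᶜ C)) (inj₁ r))

  ∨-upperʳ : ∀ A C → C ⊆ᶜ A ∨ᶜ C
  ∨-upperʳ A C r = proj₁ (join-≐ A C) (▹◃-extensive ((_∈ᶜ A) ∪ (_∈ᶜ C)) (inj₂ r))

  *-antitone : ∀ A C → A ⊆ᶜ C → C * ⊆ᶜ A *
  *-antitone A C A⊆C r = proj₁ (star-≐ A) (λ z z∈A → proj₂ (star-≐ C) r z (A⊆C z∈A))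

  isClopenAlgebra : IsClopenAlgebra em 𝔉
  isClopenAlgebra = record
    { clopenClosed     = clopenClosed
    ; isBoundedLattice = record
        { isLattice = record
            { isPartialOrder = record
                { isPreorder = record
                    { isEquivalence = record
                        { refl  = (λ r → r) , (λ r → r)
                        ; sym   = λ (f , g) → g , f
                        ; trans = λ (f , g) (h , k) → (λ r → h (f r)) , (λ r → g (k r)) }
                    ; reflexive = proj₁
                    ; trans     = λ f g r → g (f r) }
                ; antisym = _,_ }
            ; supremum = λ A C → ∨-upperˡ A C , ∨-upperʳ A C ,
                           λ E A⊆E C⊆E → ∨-least A C (Open-stable (proj₂ (proj₂ E))) A⊆E C⊆E
            ; infimum  = λ A C → (λ r → proj₁ (proj₂ (⊓-≐ A C) r)) , (λ r → proj₂ (proj₂ (⊓-≐ A C) r)) ,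
                           λ E E⊆A E⊆C r → proj₁ (⊓-≐ A C) (E⊆A r , E⊆C r) }
        ; maximum = λ A _ → tt
        ; minimum = λ A () }
    ; *-antitone = λ {A} {C} → *-antitone A C
    ; *-⊥        = (λ _ → tt) , (λ _ → proj₁ (star-≐ ⊥ᶜ) (λ _ ()))
    ; *-∨        = λ A C →
        (λ r → proj₁ (⊓-≐ (A *) (C *)) ( *-antitone A (A ∨ᶜ C) (∨-upperˡ A C) r
                                       , *-antitone C (A ∨ᶜ C) (∨-upperʳ A C) r)) ,
        -- The set `x S′_` is stable and contains both `A` and `C`, hence also their join.
        (λ {x} r → let (r₁ , r₂) = proj₂ (⊓-≐ (A *) (C *)) r in
           proj₁ (star-≐ (A ∨ᶜ C)) λ z → ∨-least A C (S′-stableʳ x)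
             (λ {u} → proj₂ (star-≐ A) r₁ u) (λ {u} → proj₂ (star-≐ C) r₂ u))
    ; ⊥≉⊤        = λ (_ , ⊤⊆⊥) → ⊤⊆⊥ {IsSRFSide.nonempty sideX} tt }

-- Frame morphisms induce homomorphisms by preimage

module ClopenHom (em : ExcludedMiddle ℓ) {𝔉₂ 𝔉₁ : Frame ℓ} (ax₂ : IsSRF 𝔉₂) (ax₁ : IsSRF 𝔉₁)
  (π : FrameMap 𝔉₂ 𝔉₁) (mπ : IsSRFMorphism π) where

  private
    module 𝔉₁ = Frame 𝔉₁
    module 𝔉₂ = Frame 𝔉₂
    module A₁ = ClopenAlgebra em 𝔉₁ ax₁
    module A₂ = ClopenAlgebra em 𝔉₂ ax₂
    module G₁ = GaloisProperties 𝔉₁.polarity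
    module G₂ = GaloisProperties 𝔉₂.polarity
    module G₁ᵒ = GaloisProperties (dual 𝔉₁.polarity)
    module G₂ᵒ = GaloisProperties (dual 𝔉₂.polarity)
    module C₁ = IsClopenAlgebra A₁.isClopenAlgebra
    module C₂ = IsClopenAlgebra A₂.isClopenAlgebra
  open 𝔉₁.GX using (_∈ᶜ_; _▹)
  open FrameMap π
  open IsSRFMorphism mπ

  ∥-reflect : ∀ {x y} → p₀ x 𝔉₁.∥ q₀ y → x 𝔉₂.∥ y
  ∥-reflect r = em⇒dne em (λ x∦y → I-forth x∦y r)

  -- The preimage of an open element is the polar of the `q`-preimage of a closed one; `q-closed`
  -- thus becomes openness of `p`-preimages.
  pre-∥ : ∀ y → (𝔉₁.GY.Γ y ∘ q₀) 𝔉₂.GX.◃ ≐ (λ x → p₀ x 𝔉₁.∥ y)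
  pre-∥ y =
    (λ r → em⇒dne em (λ px∦y → let (y′ , y⪯qy′ , x∦y′) = I-backʸ px∦y in x∦y′ (r y′ y⪯qy′))) ,
    (λ {x} px∥y y′ y⪯qy′ → ∥-reflect (y⪯qy′ (p₀ x) px∥y))

  pre-closed : {A : Pred 𝔉₁.∣X∣ l} → 𝔉₁.GX.Closed A → 𝔉₂.GX.Closed (A ∘ p₀)
  pre-closed (inj₁ (u , A⊆Γ , Γ⊆A)) = G₂.Closed-resp-≐ (Γ⊆A , A⊆Γ) (p-closed u)
  pre-closed (inj₂ e) = inj₂ (λ x → e (p₀ x))

  pre-open : {A : Pred 𝔉₁.∣X∣ l} → 𝔉₁.GX.Open A → 𝔉₂.GX.Open (A ∘ p₀)
  pre-open (inj₁ (y , A⊆y , y⊆A)) = G₂.Open-resp-≐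
    ((λ r → y⊆A (proj₁ (pre-∥ y) r)) , (λ r → proj₂ (pre-∥ y) (A⊆y r)))
    (G₂ᵒ.▹-open (q-closed y))
  pre-open (inj₂ u) = inj₂ (λ x → u (p₀ x))

  pre-clopen : PreservesClopen π
  pre-clopen (_ , c , o) = pre-closed c , pre-open o

  pre⁻ : 𝔉₁.GX.Clopen → 𝔉₂.GX.Clopen
  pre⁻ = pre π pre-clopen

  -- Preimages commute with polars. The back condition yields only a point above `z`, which suffices
  -- because `A` is an up-set. Joins are preserved since they are double polars.
  pre-▹ : ∀ A {y} → ((_∈ᶜ A) ▹) (q₀ y) ⇔ ((𝔉₂.GX._∈ᶜ pre⁻ A) 𝔉₂.GX.▹) y
  pre-▹ A = mk⇔
    (λ r x px∈A → ∥-reflect (r (p₀ x) px∈A))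
    (λ r z z∈A → em⇒dne em (λ z∦qy →
      let (x , z⪯px , x∦y) = I-backˣ z∦qy in x∦y (r x (G₁.Clopen-upward A z⪯px z∈A))))

  pre-∨ : ∀ A C → pre⁻ (A C₁.∨ᶜ C) 𝔉₂.GX.≈ᶜ pre⁻ A C₂.∨ᶜ pre⁻ C
  pre-∨ A C =
    (λ r → proj₁ (A₂.join-≐ (pre⁻ A) (pre⁻ C)) (λ y s → ∥-reflect (proj₂ (A₁.join-≐ A C) r (q₀ y)
       (λ x → Sum.[ Equivalence.from (pre-▹ A) (λ z z∈ → s z (inj₁ z∈)) x
                  , Equivalence.from (pre-▹ C) (λ z z∈ → s z (inj₂ z∈)) x ]′)))) ,
    A₂.∨-least (pre⁻ A) (pre⁻ C) (G₂.Open-stable (proj₂ (proj₂ (pre⁻ (A C₁.∨ᶜ C)))))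
      (A₁.∨-upperˡ A C) (A₁.∨-upperʳ A C)

  pre-* : ∀ A → pre⁻ (A C₁.*) 𝔉₂.GX.≈ᶜ (pre⁻ A) C₂.*
  pre-* A =
    (λ r → proj₁ (A₂.star-≐ (pre⁻ A)) (λ z pz∈A y ySz → ∥-reflect
       (proj₂ (A₁.star-≐ A) r (p₀ z) pz∈A (q₀ y) (Equivalence.from S-iff (z , G₁.⪯-refl , ySz))))) ,
    (λ {x} r → proj₁ (A₁.star-≐ A) (λ z z∈A y ySz → em⇒dne em (λ px∦y →
       -- `I-backʸ` replaces `y` by a larger point in the image of `q`; it is still related to `z`
       -- because `_S z`, being closed, is an up-set. Only then does `S-iff` apply.
       let (y′ , y⪯qy′ , x∦y′) = I-backʸ px∦y
           (z′ , z⪯pz′ , y′Sz′) = Equivalence.to S-iff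
             (G₁ᵒ.Closed-upward (IsSRF.S-closed ax₁ z) y⪯qy′ ySz)
       in x∦y′ (proj₂ (A₂.star-≐ (pre⁻ A)) r z′ (G₁.Clopen-upward A z⪯pz′ z∈A) y′ y′Sz′))))

  isClopenHom : IsClopenHom π A₂.isClopenAlgebra A₁.isClopenAlgebra
  isClopenHom = record
    { pc    = pre-clopen
    ; pre-∨ = pre-∨
    ; pre-∧ = λ _ _ → (λ r → r) , (λ r → r)
    ; pre-⊥ = (λ r → r) , (λ r → r)
    ; pre-⊤ = (λ r → r) , (λ r → r)
    ; pre-* = pre-* }

-- The lattice isomorphism onto the clopen algebra of the canonical frame

module _ {K L : QLattice ℓ} (h : QHom K L) where
  private
    module K = QLattice K
    module L = QLattice L
  open QHom h

  -- All equations for `g`, including its compatibility with equality, are checked after applying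
  -- `h` and pulled back by injectivity.
  inverseHom : (g : L.Carrier → K.Carrier) → (∀ b → to (g b) L.≈ b) →
               (∀ {a b} → to a L.≈ to b → a K.≈ b) → QHom L K
  inverseHom g to-g injective = record
    { func   = record { to = g ; cong = λ e → reflect (L.Eq.trans e (L.Eq.sym (to-g _))) }
    ; ∨-homo = λ a b → reflect (L.Eq.sym (L.Eq.trans (∨-homo _ _) (∨-cong (to-g a) (to-g b))))
    ; ∧-homo = λ a b → reflect (L.Eq.sym (L.Eq.trans (∧-homo _ _) (∧-cong (to-g a) (to-g b))))
    ; ⊥-homo = reflect (L.Eq.sym ⊥-homo)
    ; ⊤-homo = reflect (L.Eq.sym ⊤-homo)
    ; ν-homo = λ a → reflect (L.Eq.sym (L.Eq.trans (ν-homo _) (ν-cong (to-g a)))) }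
    where
    reflect : ∀ {b a} → b L.≈ to a → g b K.≈ a
    reflect e = injective (L.Eq.trans (to-g _) e)

    open JoinSemilattice (BoundedLattice.joinSemilattice L.boundedLattice) using (∨-cong)
    open MeetSemilattice (BoundedLattice.meetSemilattice L.boundedLattice) using (∧-cong)

    ν-cong : ∀ {a b} → a L.≈ b → L.ν a L.≈ L.ν b
    ν-cong e = L.antisym (L.ν-antitone (L.reflexive (L.Eq.sym e))) (L.ν-antitone (L.reflexive e))

module CanonicalEmbedding (em : ExcludedMiddle ℓ) (L : QLattice ℓ) where
  open QLattice L
  open CanonicalFrame em L
  private
    module Alg = ClopenAlgebra em (canonicalFrame L) isSRF
    module Ops = IsClopenAlgebra Alg.isClopenAlgebra
  open Frame (canonicalFrame L)
  open Fil using (⟨_⟩)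

  ⟨⟩-mono : ∀ {a b} → a ≤ b → ⟨ a ⟩ GX.⊆ᶜ ⟨ b ⟩
  ⟨⟩-mono a≤b {x} = Filter.up x a≤b

  ⟨⟩-injective : ∀ {a b} → ⟨ a ⟩ GX.≈ᶜ ⟨ b ⟩ → a ≈ b
  ⟨⟩-injective (f , g) = antisym (Fil.⊆-injective (λ {x} → f {x})) (Fil.⊆-injective (λ {x} → g {x}))

  ⟨⟩-ν : ∀ a → ⟨ ν a ⟩ GX.≈ᶜ ⟨ a ⟩ Ops.*
  ⟨⟩-ν a =
    (λ {x} νa∈x → proj₁ (Alg.star-≐ ⟨ a ⟩) {x} (λ z a∈z y r → ν a , νa∈x , Equivalence.to (S⇔ {y} {z}) r a∈z)) ,
    (λ {x} r → ∈-ν {x} {a} (proj₂ (Alg.star-≐ ⟨ a ⟩) {x} r))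

  -- The join of `X_a` and `X_b` is clopen, so it is `X_c` for some `c`. Injectivity of the
  -- embedding puts `c` above `a` and `b`. The converse uses that `X_(a ∨ b)` is stable.
  ⟨⟩-∨ : ∀ a b → ⟨ a ∨ b ⟩ GX.≈ᶜ ⟨ a ⟩ Ops.∨ᶜ ⟨ b ⟩
  ⟨⟩-∨ a b = (λ {x} → to {x}) , λ {x} → Alg.∨-least ⟨ a ⟩ ⟨ b ⟩
      (GaloisProperties.Open-stable polarity (Fil.∈-open (a ∨ b)))
      (λ {x} → Filter.up x (x≤x∨y a b)) (λ {x} → Filter.up x (y≤x∨y a b)) {x}
    where
    J = Ops._∨ᶜ_ ⟨ a ⟩ ⟨ b ⟩
    c = proj₁ (Fil.clopen⇒∈ (proj₂ J))
    J⊆c = proj₁ (proj₂ (Fil.clopen⇒∈ (proj₂ J)))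
    c⊆J = proj₂ (proj₂ (Fil.clopen⇒∈ (proj₂ J)))

    to : ⟨ a ∨ b ⟩ GX.⊆ᶜ J
    to {x} r = c⊆J {x} (Filter.up x (∨-least
      (Fil.⊆-injective (λ {z} s → J⊆c {z} (Alg.∨-upperˡ ⟨ a ⟩ ⟨ b ⟩ {z} s)))
      (Fil.⊆-injective (λ {z} s → J⊆c {z} (Alg.∨-upperʳ ⟨ a ⟩ ⟨ b ⟩ {z} s)))) r)

  embedding : QHom L Ops.clopenAlgebra
  embedding = record
    { func   = record { to = ⟨_⟩ ; cong = λ e → (λ {x} → ⟨⟩-mono (reflexive e) {x}) ,
                                                (λ {x} → ⟨⟩-mono (reflexive (Eq.sym e)) {x}) }
    ; ∨-homo = ⟨⟩-∨
    ; ∧-homo = λ a b →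
        (λ {x} r → proj₁ (GaloisProperties.⊓-≐ polarity ⟨ a ⟩ ⟨ b ⟩) {x}
           (Filter.up x (x∧y≤x a b) r , Filter.up x (x∧y≤y a b) r)) ,
        (λ {x} r → let (r₁ , r₂) = proj₂ (GaloisProperties.⊓-≐ polarity ⟨ a ⟩ ⟨ b ⟩) {x} r
                   in Filter.∧-mem x r₁ r₂)
    ; ⊥-homo = (λ {x} → Filter.proper x) , (λ ())
    ; ⊤-homo = (λ _ → tt) , (λ {x} _ → Filter.⊤-mem x)
    ; ν-homo = ⟨⟩-ν }

  -- The element is computed from the witnesses of clopenness that `A` carries, so the inverse
  -- involves no choice.
  representative : GX.Clopen → Carrier
  representative A = proj₁ (Fil.clopen⇒∈ (proj₂ A))

  ⟨representative⟩ : ∀ A → ⟨ representative A ⟩ GX.≈ᶜ A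
  ⟨representative⟩ A = let (_ , A⊆a , a⊆A) = Fil.clopen⇒∈ (proj₂ A)
                       in (λ {x} → a⊆A {x}) , (λ {x} → A⊆a {x})

  embedding⁻¹ : QHom Ops.clopenAlgebra L
  embedding⁻¹ = inverseHom embedding representative ⟨representative⟩ ⟨⟩-injective

-- Relational isomorphisms of frames

record IsFrameIsomorphism {𝔉 𝔊 : Frame ℓ} (π : FrameMap 𝔉 𝔊) (ρ : FrameMap 𝔊 𝔉) : Set ℓ where
  private
    module 𝔉 = Frame 𝔉
    module 𝔊 = Frame 𝔊
    module π = FrameMap π
  field
    inverseˡ : (π ∘M ρ) ≈M idMap 𝔊
    inverseʳ : (ρ ∘M π) ≈M idMap 𝔉
    ∥⇔       : ∀ {x y} → x 𝔉.∥ y ⇔ π.p₀ x 𝔊.∥ π.q₀ y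
    S⇔       : ∀ {y x} → y 𝔉.S x ⇔ π.q₀ y 𝔊.S π.p₀ x

module _ {𝔉 𝔊 : Frame ℓ} {π : FrameMap 𝔉 𝔊} {ρ : FrameMap 𝔊 𝔉} (iso : IsFrameIsomorphism π ρ) where
  private
    module 𝔉 = Frame 𝔉
    module 𝔊 = Frame 𝔊
    module X = Setoid 𝔊.X
    module Y = Setoid 𝔊.Y
    module π = FrameMap π
    module ρ = FrameMap ρ
    module GX = GaloisProperties 𝔊.polarity
    module GY = GaloisProperties (dual 𝔊.polarity)
  open IsFrameIsomorphism iso

  inverse-isFrameIsomorphism : IsFrameIsomorphism ρ π
  inverse-isFrameIsomorphism = record
    { inverseˡ = inverseʳ
    ; inverseʳ = inverseˡ
    ; ∥⇔ = mk⇔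
        (λ r → Equivalence.from ∥⇔ (𝔊.∥-resp (X.sym (proj₁ inverseˡ _)) (Y.sym (proj₂ inverseˡ _)) r))
        (λ r → 𝔊.∥-resp (proj₁ inverseˡ _) (proj₂ inverseˡ _) (Equivalence.to ∥⇔ r))
    ; S⇔ = mk⇔
        (λ r → Equivalence.from S⇔ (𝔊.S-resp (Y.sym (proj₂ inverseˡ _)) (X.sym (proj₁ inverseˡ _)) r))
        (λ r → 𝔊.S-resp (proj₂ inverseˡ _) (proj₁ inverseˡ _) (Equivalence.to S⇔ r)) }

  -- The inverse `ρ` supplies every point whose existence the morphism conditions demand, and the
  -- preimage of `Γ u` is generated by the image of `u` under `ρ`.
  isomorphism⇒morphism : IsSRF 𝔊 → IsSRFMorphism π
  isomorphism⇒morphism ax = record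
    { I-forth  = λ x∦y r → x∦y (Equivalence.from ∥⇔ r)
    ; I-backˣ  = λ {x} x∦y → ρ.p₀ x , GX.≈⇒⪯ (X.sym (proj₁ inverseˡ x)) ,
                   (λ r → x∦y (𝔊.∥-resp (proj₁ inverseˡ x) Y.refl (Equivalence.to ∥⇔ r)))
    ; I-backʸ  = λ {_} {y} x∦y → ρ.q₀ y , GY.≈⇒⪯ (Y.sym (proj₂ inverseˡ y)) ,
                   (λ r → x∦y (𝔊.∥-resp X.refl (proj₂ inverseˡ y) (Equivalence.to ∥⇔ r)))
    ; S-iff    = λ {v} {z} → mk⇔
        (λ r → ρ.p₀ z , GX.≈⇒⪯ (X.sym (proj₁ inverseˡ z)) ,
               Equivalence.from S⇔ (𝔊.S-resp Y.refl (X.sym (proj₁ inverseˡ z)) r))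
        (λ (x , z⪯px , r) → IsSRF.S-down ax (π.q₀ v) z⪯px (Equivalence.to S⇔ r))
    ; p-closed = λ u → inj₁ (ρ.p₀ u ,
        (λ u⪯px y r → Equivalence.from ∥⇔ (u⪯px _ (𝔊.∥-resp (proj₁ inverseˡ u) Y.refl (Equivalence.to ∥⇔ r)))) ,
        (λ ρu⪯x y r → 𝔊.∥-resp X.refl (proj₂ inverseˡ y) (Equivalence.to ∥⇔ (ρu⪯x (ρ.q₀ y)
           (Equivalence.from ∥⇔ (𝔊.∥-resp (X.sym (proj₁ inverseˡ u)) (Y.sym (proj₂ inverseˡ y)) r))))))
    ; q-closed = λ u → inj₁ (ρ.q₀ u ,
        (λ u⪯qy x r → Equivalence.from ∥⇔ (u⪯qy _ (𝔊.∥-resp X.refl (proj₂ inverseˡ u) (Equivalence.to ∥⇔ r)))) ,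
        (λ ρu⪯y x r → 𝔊.∥-resp (proj₁ inverseˡ x) Y.refl (Equivalence.to ∥⇔ (ρu⪯y (ρ.p₀ x)
           (Equivalence.from ∥⇔ (𝔊.∥-resp (X.sym (proj₁ inverseˡ x)) (Y.sym (proj₂ inverseˡ u)) r)))))) }

-- A frame is isomorphic to the canonical frame of its clopen algebra

module Points (em : ExcludedMiddle ℓ) (𝔉 : Frame ℓ) (ax : IsSRF 𝔉) where
  open Frame 𝔉
  open IsSRF ax
  open GaloisProperties polarity
  private
    module GYP = GaloisProperties (dual polarity)
    module Alg = ClopenAlgebra em 𝔉 ax
    module CX = Alg.CX
    module CY = Alg.CY
    module SX = IsSRFSide sideX
    module SY = IsSRFSide sideY
    𝔏 = IsClopenAlgebra.clopenAlgebra Alg.isClopenAlgebra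
    𝔊 = canonicalFrame 𝔏
    module 𝔊 = Frame 𝔊
  open IsClopenAlgebra Alg.isClopenAlgebra using (⊤ᶜ; ⊥ᶜ; _∨ᶜ_; _*)
  open CX using (_ᵒ; ᵒ-≐)
  open CY using () renaming (_ᵒ to _ᵈ; ᵒ-≐ to ᵈ-≐)
  open GX using (_∈ᶜ_; _≈ᶜ_)

  -- Clopen elements are open, hence stable, so the double polar returns `A`.
  ᵒᵈ : ∀ A → (A ᵒ) ᵈ ≈ᶜ A
  ᵒᵈ A =
    (λ r → proj₂ (Open-stable (proj₂ (proj₂ A))) (λ y s → proj₂ (ᵈ-≐ (A ᵒ)) r y (proj₁ (ᵒ-≐ A) s))) ,
    (λ r → proj₁ (ᵈ-≐ (A ᵒ)) (λ y s → proj₂ (ᵒ-≐ A) s _ r))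

  ᵈᵒ : ∀ B → (B ᵈ) ᵒ GY.≈ᶜ B
  ᵈᵒ B =
    (λ r → proj₂ (GYP.Open-stable (proj₂ (proj₂ B))) (λ x s → proj₂ (ᵒ-≐ (B ᵈ)) r x (proj₁ (ᵈ-≐ B) s))) ,
    (λ r → proj₁ (ᵒ-≐ (B ᵈ)) (λ x s → proj₂ (ᵈ-≐ B) s _ r))

  neighbourhoods : ∣X∣ → Filter 𝔏
  neighbourhoods x = record
    { mem    = λ A → proj₁ A x
    ; ⊤-mem  = tt
    ; up     = λ A⊆C → A⊆C
    ; ∧-mem  = λ {A} {C} r s → proj₁ (⊓-≐ A C) (r , s)
    ; proper = λ () }

  -- `A` is a member when it is contained in `_∥ y`. Stability of `_∥ y` gives closure under joins.
  coneighbourhoods : ∣Y∣ → Ideal 𝔏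
  coneighbourhoods y = record
    { mem    = λ A → proj₁ (A ᵒ) y
    ; ⊥-mem  = proj₁ (ᵒ-≐ ⊥ᶜ) (λ x ())
    ; down   = λ {A} {C} A⊆C r → proj₁ (ᵒ-≐ A) (λ x x∈A → proj₂ (ᵒ-≐ C) r x (A⊆C x∈A))
    ; ∨-mem  = λ {A} {C} r s → proj₁ (ᵒ-≐ (A ∨ᶜ C)) (λ x → Alg.∨-least A C
                 (Open-stable (inj₁ (y , (λ t → t) , (λ t → t))))
                 (λ {z} → proj₂ (ᵒ-≐ A) r z) (λ {z} → proj₂ (ᵒ-≐ C) s z))
    ; proper = λ r → let (x , x∦y) = SY.quasi-serial y in x∦y (proj₂ (ᵒ-≐ ⊤ᶜ) r x tt) }

  module _ (F : Filter 𝔏) where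
    private
      isFilter : CX.ClopenFilter ⟦ Filter.mem F ⟧
      isFilter = record
        { ⊤-mem  = Filter.⊤-mem F
        ; up     = λ {A} {C} → Filter.up F {A} {C}
        ; ∧-mem  = λ {A} {C} → Filter.∧-mem F {A} {C}
        ; proper = Filter.proper F }

    pointˣ : ∣X∣
    pointˣ = CX.point isFilter

    pointˣ∈ : ∀ A → pointˣ ∈ᶜ A ⇔ _∈ᶠ_ 𝔏 A F
    pointˣ∈ = CX.point∈ isFilter

  module _ (J : Ideal 𝔏) where
    private
      isFilter : CY.ClopenFilter (λ B → _∈ⁱ_ 𝔏 (B ᵈ) J)
      isFilter = record
        { ⊤-mem  = Ideal.down J {CY.⊤ᶜ ᵈ} {⊥ᶜ} (λ {x} r →
            let (y , x∦y) = SX.quasi-serial x in contradiction (proj₂ (ᵈ-≐ CY.⊤ᶜ) r y tt) x∦y)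
            (Ideal.⊥-mem J)
        ; up     = λ {B} {D} B⊆D → Ideal.down J {D ᵈ} {B ᵈ}
            (λ r → proj₁ (ᵈ-≐ B) (λ y y∈B → proj₂ (ᵈ-≐ D) r y (B⊆D y∈B)))
        -- The polar of `B ∩ D` lies below the join of the polars: a `y` in the polar of their union
        -- belongs to the double polars of `B` and `D`, hence to both.
        ; ∧-mem  = λ {B} {D} r s → Ideal.down J {(B CY.∧ᶜ D) ᵈ} {(B ᵈ) ∨ᶜ (D ᵈ)}
            (λ {x} t → proj₁ (Alg.join-≐ (B ᵈ) (D ᵈ)) (λ y u → proj₂ (ᵈ-≐ (B CY.∧ᶜ D)) t y
               (proj₁ (GYP.⊓-≐ B D)
                  ( proj₁ (ᵈᵒ B) (proj₁ (ᵒ-≐ (B ᵈ)) (λ z z∈ → u z (inj₁ z∈)))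
                  , proj₁ (ᵈᵒ D) (proj₁ (ᵒ-≐ (D ᵈ)) (λ z z∈ → u z (inj₂ z∈)))))))
            (Ideal.∨-mem J {B ᵈ} {D ᵈ} r s)
        ; proper = λ r → Ideal.proper J (Ideal.down J {⊤ᶜ} {CY.⊥ᶜ ᵈ} (λ _ → proj₁ (ᵈ-≐ CY.⊥ᶜ) (λ y ())) r) }

    pointʸ : ∣Y∣
    pointʸ = CY.point isFilter

    pointʸ∈ : ∀ B → pointʸ GY.∈ᶜ B ⇔ _∈ⁱ_ 𝔏 (B ᵈ) J
    pointʸ∈ = CY.point∈ isFilter

    pointʸ∈ᵒ : ∀ A → pointʸ GY.∈ᶜ (A ᵒ) ⇔ _∈ⁱ_ 𝔏 A J
    pointʸ∈ᵒ A = mk⇔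
      (λ r → Ideal.down J {A} {(A ᵒ) ᵈ} (proj₂ (ᵒᵈ A)) (Equivalence.to (pointʸ∈ (A ᵒ)) r))
      (λ r → Equivalence.from (pointʸ∈ (A ᵒ)) (Ideal.down J {(A ᵒ) ᵈ} {A} (proj₁ (ᵒᵈ A)) r))

  ∈ᵒ-injective : ∀ {y w} → (∀ A → y GY.∈ᶜ (A ᵒ) ⇔ w GY.∈ᶜ (A ᵒ)) → y ≈ʸ w
  ∈ᵒ-injective e = CY.∈ᶜ-injective (λ B → mk⇔
    (λ r → proj₁ (ᵈᵒ B) (Equivalence.to   (e (B ᵈ)) (proj₂ (ᵈᵒ B) r)))
    (λ r → proj₁ (ᵈᵒ B) (Equivalence.from (e (B ᵈ)) (proj₂ (ᵈᵒ B) r))))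

  toCanonical : FrameMap 𝔉 𝔊
  toCanonical = record
    { p = record { to = neighbourhoods
                 ; cong = λ e → (λ {A} → GX.∈ᶜ-resp A e) , (λ {A} → GX.∈ᶜ-resp A (Setoid.sym X e)) }
    ; q = record { to = coneighbourhoods
                 ; cong = λ e → (λ {A} → GY.∈ᶜ-resp (A ᵒ) e) , (λ {A} → GY.∈ᶜ-resp (A ᵒ) (Setoid.sym Y e)) } }

  fromCanonical : FrameMap 𝔊 𝔉
  fromCanonical = record
    { p = record { to = pointˣ ; cong = λ {F} {F′} (f , g) → CX.∈ᶜ-injective (λ A → mk⇔
            (λ r → Equivalence.from (pointˣ∈ F′ A) (f {A} (Equivalence.to (pointˣ∈ F A) r)))
            (λ r → Equivalence.from (pointˣ∈ F A) (g {A} (Equivalence.to (pointˣ∈ F′ A) r)))) }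
    ; q = record { to = pointʸ ; cong = λ {J} {J′} (f , g) → ∈ᵒ-injective (λ A → mk⇔
            (λ r → Equivalence.from (pointʸ∈ᵒ J′ A) (f {A} (Equivalence.to (pointʸ∈ᵒ J A) r)))
            (λ r → Equivalence.from (pointʸ∈ᵒ J A) (g {A} (Equivalence.to (pointʸ∈ᵒ J′ A) r)))) } }

  -- The right-hand side is the description of `S` in the canonical frame, read at the filter of `x`
  -- and the ideal of `y`.
  S⇔* : ∀ {y x} → y S x ⇔ (∀ {A} → x ∈ᶜ A → y GY.∈ᶜ ((A *) ᵒ))
  S⇔* {y} {x} = mk⇔ to from
    where
    to : y S x → ∀ {A} → x ∈ᶜ A → y GY.∈ᶜ ((A *) ᵒ)
    to ySx {A} x∈A = proj₁ (ᵒ-≐ (A *)) (λ u u∈A* → proj₂ (Alg.star-≐ A) u∈A* x x∈A y ySx)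

    -- y S_ is determined by the least elements z of clopen elements, for
    -- which S z is clopen, hence costable.
    from : (∀ {A} → x ∈ᶜ A → y GY.∈ᶜ ((A *) ᵒ)) → y S x
    from r = em⇒dne em λ ¬ySx → absurd (S-closedˢ y ¬ySx)
      where
      absurd : ¬ (∃[ A ] x ∈ᶜ A × (_∈ᶜ A) ⊆ ∁ (y S_))
      absurd (A@(_ , inj₂ e , _) , x∈A , A⊆) = e x x∈A
      absurd (A@(_ , inj₁ (z , A≐Γ) , _) , x∈A , A⊆) = A⊆ (proj₂ A≐Γ ⪯-refl)
        (proj₂ (GYP.Open-stable (proj₂ (S-clopen z (IsClopen-resp-≐ A≐Γ (proj₂ A)))))
          (λ u u∈ → proj₂ (ᵒ-≐ (A *)) (r {A} x∈A) u (proj₁ (Alg.star-Γ A A≐Γ) u∈)))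

  isFrameIsomorphism : IsFrameIsomorphism toCanonical fromCanonical
  isFrameIsomorphism = record
    { inverseˡ = (λ F → (λ {A} → Equivalence.to (pointˣ∈ F A)) , (λ {A} → Equivalence.from (pointˣ∈ F A))) ,
                 (λ J → (λ {A} → Equivalence.to (pointʸ∈ᵒ J A)) , (λ {A} → Equivalence.from (pointʸ∈ᵒ J A)))
    ; inverseʳ = (λ x → CX.∈ᶜ-injective (pointˣ∈ (neighbourhoods x))) ,
                 (λ y → ∈ᵒ-injective (pointʸ∈ᵒ (coneighbourhoods y)))
    ; ∥⇔       = λ {x} {y} → mk⇔
        -- By `∥-open` some clopen neighbourhood of `x` lies inside `_∥ y`; it is the common member
        -- of the filter of `x` and the ideal of `y`.
        (λ x∥y → let (A , x∈A , A⊆) = ∥-open y x∥y in A , x∈A , proj₁ (ᵒ-≐ A) (λ z z∈A → A⊆ z∈A))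
        (λ (A , x∈A , y∈Aᵒ) → proj₂ (ᵒ-≐ A) y∈Aᵒ x x∈A)
    ; S⇔       = λ {y} {x} → mk⇔ (S-preserve {y} {x}) (S-reflect {y} {x}) }
    where
    S𝔊⇔ : ∀ {y x} → coneighbourhoods y 𝔊.S neighbourhoods x ⇔ (∀ {A} → x ∈ᶜ A → y GY.∈ᶜ ((A *) ᵒ))
    S𝔊⇔ {y} {x} = CanonicalFrame.S⇔ em 𝔏 {coneighbourhoods y} {neighbourhoods x}

    S-preserve : ∀ {y x} → y S x → coneighbourhoods y 𝔊.S neighbourhoods x
    S-preserve {y} {x} r {B} =
      Equivalence.from (S𝔊⇔ {y} {x}) (λ {A} → Equivalence.to (S⇔* {y} {x}) r {A}) {B}

    S-reflect : ∀ {y x} → coneighbourhoods y 𝔊.S neighbourhoods x → y S x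
    S-reflect {y} {x} r =
      Equivalence.from (S⇔* {y} {x}) (λ {A} → Equivalence.to (S𝔊⇔ {y} {x}) (λ {B} → r {B}) {A})

  toCanonical-isMorphism : IsSRFMorphism toCanonical
  toCanonical-isMorphism = isomorphism⇒morphism {𝔉 = 𝔉} {𝔊} {toCanonical} {fromCanonical}
    isFrameIsomorphism (CanonicalFrame.isSRF em 𝔏)

  fromCanonical-isMorphism : IsSRFMorphism fromCanonical
  fromCanonical-isMorphism = isomorphism⇒morphism {𝔉 = 𝔊} {𝔉} {fromCanonical} {toCanonical}
    (inverse-isFrameIsomorphism {𝔉 = 𝔉} {𝔊} {toCanonical} {fromCanonical} isFrameIsomorphism) ax

module _ (em : ExcludedMiddle ℓ) {𝔉₂ 𝔉₁ : Frame ℓ} (ax₂ : IsSRF 𝔉₂) (ax₁ : IsSRF 𝔉₁)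
  (π : FrameMap 𝔉₂ 𝔉₁) (mπ : IsSRFMorphism π) where
  private
    module P₁ = Points em 𝔉₁ ax₁
    module P₂ = Points em 𝔉₂ ax₂
    module Hom = ClopenHom em ax₂ ax₁ π mπ
    module C₁ = ClopenAlgebra.CX em 𝔉₁ ax₁
    module C₂ = ClopenAlgebra.CX em 𝔉₂ ax₂
  open FrameMap π

  -- Points are determined by the clopen elements containing them, so it suffices to compare
  -- memberships. On `Y` the test sets are polars, which `pre-▹` moves across `π`.
  fromCanonical-natural :
    (π ∘M P₂.fromCanonical) ≈M (P₁.fromCanonical ∘M canonicalMap (IsClopenHom.preHom Hom.isClopenHom))
  fromCanonical-natural =
    (λ F → let F′ = preFilter (IsClopenHom.preHom Hom.isClopenHom) F in C₁.∈ᶜ-injective (λ A → mk⇔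
       (λ r → Equivalence.from (P₁.pointˣ∈ F′ A) (Equivalence.to (P₂.pointˣ∈ F (Hom.pre⁻ A)) r))
       (λ r → Equivalence.from (P₂.pointˣ∈ F (Hom.pre⁻ A)) (Equivalence.to (P₁.pointˣ∈ F′ A) r)))) ,
    (λ J → let J′ = preIdeal (IsClopenHom.preHom Hom.isClopenHom) J in P₁.∈ᵒ-injective (λ A → mk⇔
       (λ r → Equivalence.from (P₁.pointʸ∈ᵒ J′ A) (Equivalence.to (P₂.pointʸ∈ᵒ J (Hom.pre⁻ A))
                (proj₁ (C₂.ᵒ-≐ (Hom.pre⁻ A)) (Equivalence.to (Hom.pre-▹ A) (proj₂ (C₁.ᵒ-≐ A) r)))))
       (λ r → proj₁ (C₁.ᵒ-≐ A) (Equivalence.from (Hom.pre-▹ A) (proj₂ (C₂.ᵒ-≐ (Hom.pre⁻ A))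
                (Equivalence.from (P₂.pointʸ∈ᵒ J (Hom.pre⁻ A)) (Equivalence.to (P₁.pointʸ∈ᵒ J′ A) r)))))))

-- Were these transparent, comparing them would unfold all the proofs they contain.
opaque
  𝙵-wellDefined : ExcludedMiddle ℓ → 𝙵-WellDefined ℓ
  𝙵-wellDefined em = record
    { object   = CanonicalFrame.isSRF em
    ; morphism = CanonicalMap.isSRFMorphism em }

  𝙻*-wellDefined : (em : ExcludedMiddle ℓ) → 𝙻*-WellDefined em
  𝙻*-wellDefined em = record
    { object   = ClopenAlgebra.isClopenAlgebra em
    ; morphism = ClopenHom.isClopenHom em }

opaque
  unfolding 𝙵-wellDefined 𝙻*-wellDefined

  unit : (em : ExcludedMiddle ℓ) →
         NaturalIsomorphism idF (𝙻* em (𝙻*-wellDefined em) ∘F 𝙵 (𝙵-wellDefined em))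
  unit em = record
    { to      = embedding
    ; from    = embedding⁻¹
    ; to∙from = ⟨representative⟩
    ; from∙to = λ L a → ⟨⟩-injective L (⟨representative⟩ L (Fil.⟨_⟩ L a))
    ; natural = λ f a → (λ r → r) , (λ r → r) }
    where
    open CanonicalEmbedding em
    open CanonicalFrame em

  unit-∈ : (em : ExcludedMiddle ℓ) (L : QLattice ℓ) (a : QLattice.Carrier L) (x : Filter L) →
           ⟦ proj₁ (QHom.to (NaturalIsomorphism.to (unit em) L) a) ⟧ x ⇔ _∈ᶠ_ L a x
  unit-∈ em L a x = mk⇔ (λ r → r) (λ r → r)

  counit : (em : ExcludedMiddle ℓ) →
           NaturalIsomorphism idF (𝙵 (𝙵-wellDefined em) ∘F 𝙻* em (𝙻*-wellDefined em))
  counit {ℓ} em = record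
    { to      = to
    ; from    = from
    ; to∙from = λ (𝔉 , ax) → IsFrameIsomorphism.inverseˡ (Points.isFrameIsomorphism em 𝔉 ax)
    ; from∙to = λ (𝔉 , ax) → IsFrameIsomorphism.inverseʳ (Points.isFrameIsomorphism em 𝔉 ax)
    ; natural = λ {A} {B} → natural {A} {B} }
    where
    module G = Functor (𝙵 (𝙵-wellDefined em) ∘F 𝙻* em (𝙻*-wellDefined em))
    open Category (op (𝐒𝐑𝐅* ℓ))

    -- Arrows here belong to the opposite category, so the component out of a frame is the map that
    -- leads from the canonical frame back to it.
    to : ∀ A → A ⇒ G.F₀ A
    to (𝔉 , ax) = Points.fromCanonical em 𝔉 ax , Points.fromCanonical-isMorphism em 𝔉 ax

    from : ∀ A → G.F₀ A ⇒ A
    from (𝔉 , ax) = Points.toCanonical em 𝔉 ax , Points.toCanonical-isMorphism em 𝔉 ax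

    natural : ∀ {A B} (f : A ⇒ B) →
              _≈_ {A} {G.F₀ B} (_∙_ {A} {B} {G.F₀ B} (to B) f)
                               (_∙_ {A} {G.F₀ A} {G.F₀ B} (G.F₁ {A} {B} f) (to A))
    natural {_ , ax₁} {_ , ax₂} (π , mπ) = fromCanonical-natural em ax₂ ax₁ π mπ

theorem6p2 : ∀ {ℓ : Level} (em : ExcludedMiddle ℓ) →
    Σ[ wdF ∈ 𝙵-WellDefined ℓ ]
    Σ[ wdL ∈ 𝙻*-WellDefined em ]
    (Σ[ η ∈ NaturalIsomorphism idF (𝙻* em wdL ∘F 𝙵 wdF) ]
    (∀ (L : QLattice ℓ) (a : QLattice.Carrier L) (x : Filter L) →
    ⟦ proj₁ (QHom.to (NaturalIsomorphism.to η L) a) ⟧ x ⇔ _∈ᶠ_ L a x))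
    × NaturalIsomorphism idF (𝙵 wdF ∘F 𝙻* em wdL)
theorem6p2 em =
  𝙵-wellDefined em , 𝙻*-wellDefined em ,
  (unit em , unit-∈ em) , counit em
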